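{- There is an algorithm that, given a set $\mathcal{R}$ of rules on a finite ground set $Q$ and a subset $X\subseteq Q$, decides whether $X\in\mathcal{A}(\mathcal{R})$ in linear time, i.e. in time $O(l(\mathcal{R}))$.
   Context: A rule (Horn rule) on $Q$ is a pair $(A,q)$ with $A\subseteq Q$ and $q\in Q$. The rule $(A,q)$ accepts a set $X\subseteq Q$ if $q\in X$ implies $X\cap A\neq\emptyset$. For a set $\mathcal{R}$ of rules, $\mathcal{K}(\mathcal{R})$ is the family of subsets of $Q$ accepted by all rules of $\mathcal{R}$ (it is union-closed and contains $\emptyset$). A tight path from $\emptyset$ to $X$ in a family $\mathcal{K}$ is a sequence $\emptyset=Y_0\subseteq Y_1\subseteq\dots\subseteq Y_k=X$ of members of $\mathcal{K}$ with $|Y_{i+1}\setminus Y_i|=1$. $\mathcal{A}(\mathcal{R})$ is the family of all $K\in\mathcal{K}(\mathcal{R})$ for which there is a tight path from $\emptyset$ to $K$ in $\mathcal{K}(\mathcal{R})$ (it is the unique maximal antimatroid contained in $\mathcal{K}(\mathcal{R})$, where an antimatroid is a union-closed family in which every nonempty member $X$ has some $x\in X$ with $X\setminus\{x\}$ a member). The input size is $l(\mathcal{R})=\sum_{(A,q)\in\mathcal{R}}(|A|+1)$, and it is assumed that $l(\mathcal{R})\ge |Q|$. -}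

module Defs where

open import Data.Bool using (Bool; true; false; if_then_else_)
open import Data.Fin using (Fin; toℕ)
open import Data.Fin.Subset using (Subset; _∈_; _⊆_; _∩_; _─_; ∣_∣; Nonempty; ⊥)
open import Data.List using (List; []; _∷_; _++_; length; map)
open import Data.List.Membership.Propositional using () renaming (_∈_ to _∈ₗ_)
open import Data.List.Relation.Unary.All using (All)
open import Data.List.Relation.Unary.Unique.Propositional using (Unique)
open import Data.Nat using (ℕ; zero; suc; pred; _+_; _*_; _≤_; _≡ᵇ_; _<ᵇ_)
open import Data.Nat.ListAction using (sum)
open import Data.Product using (_×_; _,_; proj₁; ∃-syntax)
open import Function.Bundles using (_⇔_)
open import Level using (0ℓ)
open import Relation.Binary.PropositionalEquality using (_≡_)
open import Relation.Nullary.Reflects using (Reflects)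
open import Relation.Unary using (Pred)

-- The ground set is Q = Fin n.

Rule : ℕ → Set
Rule n = Subset n × Fin n

Accepts : ∀ {n} → Rule n → Pred (Subset n) 0ℓ
Accepts (A , q) X = q ∈ X → Nonempty (X ∩ A)

-- A finite set of rules is a list of rules; distinctness of the entries
-- (Unique) is a separate hypothesis wherever it matters.

𝒦 : ∀ {n} → List (Rule n) → Pred (Subset n) 0ℓ
𝒦 R X = All (λ r → Accepts r X) R

data TightPath {n} (𝓕 : Pred (Subset n) 0ℓ) (Y₀ : Subset n) : Pred (Subset n) 0ℓ where
  start  : 𝓕 Y₀ → TightPath 𝓕 Y₀ Y₀
  extend : ∀ {Y Z} → TightPath 𝓕 Y₀ Y → 𝓕 Z → Y ⊆ Z → ∣ Z ─ Y ∣ ≡ 1 →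
           TightPath 𝓕 Y₀ Z

-- ⊥ is the empty subset.
𝒜 : ∀ {n} → List (Rule n) → Pred (Subset n) 0ℓ
𝒜 R K = 𝒦 R K × TightPath (𝒦 R) ⊥ K

ℓ : ∀ {n} → List (Rule n) → ℕ
ℓ R = sum (map (λ r → ∣ proj₁ r ∣ + 1) R)

-- Model of computation: a random access machine with structured control,
-- having registers and arrays of natural numbers.  A program mentions finitely
-- many registers and arrays; each array is addressed indirectly through a
-- register.  Every elementary command and every test costs one time unit.
-- The only arithmetic is successor and predecessor, so after t steps no stored
-- number exceeds the largest input or program constant by more than t: unit
-- cost is charged only for operations on words of O(log (input + t)) bits.

Reg Arr : Set
Reg = ℕ
Arr = ℕ

data Test : Set where
  less equal : Reg → Reg → Test

infixr 5 _⨾_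

data Program : Set where
  skip      : Program
  const     : Reg → ℕ → Program
  copy      : Reg → Reg → Program
  inc dec   : Reg → Program
  load      : Reg → Arr → Reg → Program
  store     : Arr → Reg → Reg → Program
  _⨾_       : Program → Program → Program
  ifThenElse : Test → Program → Program → Program
  while     : Test → Program → Program

record State : Set where
  constructor state
  field
    reg : Reg → ℕ
    arr : Arr → ℕ → ℕ

open State public

update : {B : Set} → (ℕ → B) → ℕ → B → (ℕ → B)
update f i v j = if j ≡ᵇ i then v else f j

setReg : Reg → ℕ → State → State
setReg x v (state r a) = state (update r x v) a

setArr : Arr → ℕ → ℕ → State → State
setArr b i v (state r a) = state r (update a b (update (a b) i v))

test : Test → State → Bool
test (less x y)  s = reg s x <ᵇ reg s y
test (equal x y) s = reg s x ≡ᵇ reg s y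

-- ⟨ P , s ⟩⇓⟨ s′ , t ⟩: P started in s halts in s′ after exactly t time units.
data ⟨_,_⟩⇓⟨_,_⟩ : Program → State → State → ℕ → Set where
  skip⇓  : ∀ {s} → ⟨ skip , s ⟩⇓⟨ s , 1 ⟩
  const⇓ : ∀ {s x k} → ⟨ const x k , s ⟩⇓⟨ setReg x k s , 1 ⟩
  copy⇓  : ∀ {s x y} → ⟨ copy x y , s ⟩⇓⟨ setReg x (reg s y) s , 1 ⟩
  inc⇓   : ∀ {s x} → ⟨ inc x , s ⟩⇓⟨ setReg x (suc (reg s x)) s , 1 ⟩
  dec⇓   : ∀ {s x} → ⟨ dec x , s ⟩⇓⟨ setReg x (pred (reg s x)) s , 1 ⟩
  load⇓  : ∀ {s x b i} →
           ⟨ load x b i , s ⟩⇓⟨ setReg x (arr s b (reg s i)) s , 1 ⟩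
  store⇓ : ∀ {s b i x} →
           ⟨ store b i x , s ⟩⇓⟨ setArr b (reg s i) (reg s x) s , 1 ⟩
  seq⇓   : ∀ {P P′ s s′ s″ t t′} →
           ⟨ P , s ⟩⇓⟨ s′ , t ⟩ → ⟨ P′ , s′ ⟩⇓⟨ s″ , t′ ⟩ →
           ⟨ P ⨾ P′ , s ⟩⇓⟨ s″ , t + t′ ⟩
  then⇓  : ∀ {b P P′ s s′ t} → test b s ≡ true → ⟨ P , s ⟩⇓⟨ s′ , t ⟩ →
           ⟨ ifThenElse b P P′ , s ⟩⇓⟨ s′ , suc t ⟩
  else⇓  : ∀ {b P P′ s s′ t} → test b s ≡ false → ⟨ P′ , s ⟩⇓⟨ s′ , t ⟩ →
           ⟨ ifThenElse b P P′ , s ⟩⇓⟨ s′ , suc t ⟩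
  done⇓  : ∀ {b P s} → test b s ≡ false → ⟨ while b P , s ⟩⇓⟨ s , 1 ⟩
  loop⇓  : ∀ {b P s s′ s″ t t′} → test b s ≡ true →
           ⟨ P , s ⟩⇓⟨ s′ , t ⟩ → ⟨ while b P , s′ ⟩⇓⟨ s″ , t′ ⟩ →
           ⟨ while b P , s ⟩⇓⟨ s″ , suc (t + t′) ⟩

-- Subsets are presented to the machine as lists of their elements, in an
-- arbitrary order and without repetition.
Lists : ∀ {n} → List (Fin n) → Subset n → Set
Lists xs A = Unique xs × (∀ x → x ∈ₗ xs ⇔ x ∈ A)

block : ∀ {n} → List (Fin n) → List ℕ
block xs = length xs ∷ map toℕ xs

data EncodesRules {n} : List (Rule n) → List ℕ → Set where
  []  : EncodesRules [] []
  _∷_ : ∀ {A q R xs w} → Lists xs A → EncodesRules R w →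
        EncodesRules ((A , q) ∷ R) (toℕ q ∷ block xs ++ w)

-- An instance is the word  n, |X|, elements of X, number of rules, rules,
-- a rule (A , q) being the word  q, |A|, elements of A.
data Encodes {n} (R : List (Rule n)) (X : Subset n) : List ℕ → Set where
  encode : ∀ {xs w} → Lists xs X → EncodesRules R w →
           Encodes R X (n ∷ block xs ++ length R ∷ w)

at : List ℕ → ℕ → ℕ
at []       _       = 0
at (x ∷ _)  zero    = x
at (_ ∷ xs) (suc i) = at xs i

-- The input occupies array 0; everything else is 0.
initial : List ℕ → State
initial w = state (λ _ → 0) (update (λ _ _ → 0) 0 (at w))

-- The answer is returned in register 0: 1 for yes, 0 for no.
Answers : State → Set → Set
Answers s Y = ∃[ b ] Reflects Y b × reg s 0 ≡ (if b then 1 else 0)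

_∈O_ : (ℕ → ℕ) → (ℕ → ℕ) → Set
f ∈O g = ∃[ c ] ∃[ N ] (∀ m → N ≤ m → f m ≤ c * g m)

DecidesWithin : ∀ {n} → Program → ℕ → List ℕ → List (Rule n) → Subset n → Set
DecidesWithin P T w R X =
  ∃[ s ] ∃[ t ] ⟨ P , initial w ⟩⇓⟨ s , t ⟩ × t ≤ T × Answers s (𝒜 R X)

{-# OPTIONS --safe #-}
-- Greedy closure: an element q ∈ X may be added to the current set Y as soon as every rule
-- with head q is hit, i.e. contains q or meets Y.  Enlarging Y never invalidates this, so the
-- elements added form a tight path from ∅ to a set Y ⊆ X which contains every member of
-- 𝒜(R) below X; hence X ∈ 𝒜(R) iff |Y| = |X|.  For linear time, cnt[q] counts the
-- unhit rules with head q, and each a ∈ Q has a linked list of its unprocessed occurrences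
-- in rules.  Every occurrence is unlinked at most once, when a reaches the front of the
-- queue of added elements.
--
-- Each loop of the program has a loop-free body, so a strictly decreasing measure on its
-- invariant bounds the running time.
module Submission where

open import Defs
open import Data.Bool using (true; false; if_then_else_; not; T)
import Data.Empty as Empty
open import Data.Fin using (Fin; zero; suc; toℕ)
import Data.Fin.Properties as Fin
open import Data.Fin.Subset using (Subset; _∈_; _∉_; _⊆_; _∩_; _∪_; _─_; _-_; ∣_∣; Nonempty; ⊥; ⁅_⁆; inside; outside)
open import Data.Fin.Subset.Properties
open import Data.List using (List; []; _∷_; _++_; length; map; _ʳ++_)
open import Data.List.Membership.Propositional using () renaming (_∈_ to _∈ₗ_)
open import Data.List.Membership.Propositional.Properties using (∈-map⁺)
open import Data.List.Relation.Unary.All as All using (All; []; _∷_)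
import Data.List.Relation.Unary.All.Properties as All
open import Data.List.Relation.Unary.AllPairs using ([]; _∷_)
open import Data.List.Relation.Unary.Any using (here; there)
import Data.List.Relation.Unary.Any.Properties as Any
open import Data.List.Relation.Unary.Unique.Propositional using (Unique; head; tail)
open import Data.Nat using (ℕ; zero; suc; pred; _+_; _*_; _∸_; _≤_; _<_; _≡ᵇ_; z≤n; s≤s)
import Data.Nat as ℕ
open import Data.Nat.ListAction using (sum)
open import Data.Nat.Properties hiding (_≟_)
open import Data.Nat.Tactic.RingSolver using (solve-∀)
open import Data.Product using (_×_; _,_; proj₁; proj₂; ∃-syntax)
open import Data.Sum using (_⊎_; inj₁; inj₂; map₂)
open import Data.Unit using (⊤; tt)
open import Data.Vec using ([]; _∷_; here; there)
open import Function.Bundles using (module Equivalence)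
open import Relation.Binary.PropositionalEquality
open import Relation.Nullary using (¬_; yes; no; contradiction)
open import Relation.Nullary.Reflects using (ofʸ; ofⁿ)

-- Loop-free programs and the timed while rule

-- A counter `cnt[q]` can be trusted only once all rules with head `q` have been read; before that,
-- a zero may be premature. The rules are therefore read while no element is marked: `strike`,
-- shared with the propagation, can then run during reading without queueing anything, and marking
-- `X` afterwards seeds the queue. A rule containing its own head counts as hit before that head is
-- in `Y`, so it is struck on reading, and the head gets no list cell in it. Hence cells record only
-- members different from the head. Maximality depends on this: when a tight path adds the head of a
-- rule, a member other than the head that meets the new set was already present. As loop bodies are
-- loop-free, the two nested iterations (members within rules, occurrences within queue entries) are
-- flattened: each step branches on its mode, and one measure covers both levels.

exec : Program → State → State
exec skip                s = s
exec (const x k)         s = setReg x k s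
exec (copy x y)          s = setReg x (reg s y) s
exec (inc x)             s = setReg x (suc (reg s x)) s
exec (dec x)             s = setReg x (pred (reg s x)) s
exec (load x b i)        s = setReg x (arr s b (reg s i)) s
exec (store b i x)       s = setArr b (reg s i) (reg s x) s
exec (P ⨾ P′)            s = exec P′ (exec P s)
exec (ifThenElse b P P′) s = if test b s then exec P s else exec P′ s
exec (while _ _)         s = s

LoopFree : Program → Set
LoopFree (P ⨾ P′)            = LoopFree P × LoopFree P′
LoopFree (ifThenElse _ P P′) = LoopFree P × LoopFree P′
LoopFree (while _ _)         = Empty.⊥
LoopFree _                   = ⊤

-- A conditional pays for both branches, which gives a bound depending on the program only.
cost : Program → ℕ
cost (P ⨾ P′)            = cost P + cost P′
cost (ifThenElse _ P P′) = suc (cost P + cost P′)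
cost _                   = 1

-- Passing from the relation to the function `exec` lets final states compute, so many invariant
-- fields below are inherited unchanged or proved by `refl`.
exec-⇓ : ∀ P s → LoopFree P → ∃[ t ] ⟨ P , s ⟩⇓⟨ exec P s , t ⟩ × t ≤ cost P
exec-⇓ skip          s _ = 1 , skip⇓ , ≤-refl
exec-⇓ (const x k)   s _ = 1 , const⇓ , ≤-refl
exec-⇓ (copy x y)    s _ = 1 , copy⇓ , ≤-refl
exec-⇓ (inc x)       s _ = 1 , inc⇓ , ≤-refl
exec-⇓ (dec x)       s _ = 1 , dec⇓ , ≤-refl
exec-⇓ (load x b i)  s _ = 1 , load⇓ , ≤-refl
exec-⇓ (store b i x) s _ = 1 , store⇓ , ≤-refl
exec-⇓ (P ⨾ P′) s (f , f′) =
  let (t , d , t≤) = exec-⇓ P s f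
      (t′ , d′ , t′≤) = exec-⇓ P′ (exec P s) f′
  in t + t′ , seq⇓ d d′ , +-mono-≤ t≤ t′≤
exec-⇓ (ifThenElse b P P′) s (f , f′) with test b s in eq
... | true  = let (t , d , t≤) = exec-⇓ P s f
              in suc t , then⇓ eq d , s≤s (≤-trans t≤ (m≤m+n _ _))
... | false = let (t , d , t≤) = exec-⇓ P′ s f′
              in suc t , else⇓ eq d , s≤s (≤-trans t≤ (m≤n+m _ (cost P)))

Halts : Program → State → ℕ → (State → Set) → Set
Halts P s T Q = ∃[ s′ ] ∃[ t ] ⟨ P , s ⟩⇓⟨ s′ , t ⟩ × t ≤ T × Q s′

-- For a concrete program `LoopFree P` reduces to a product of unit types, so the implicit argument
-- is found by eta; the same holds for `KeepsReg` and `KeepsArr` below.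
straight : ∀ P s (Q : State → Set) {f : LoopFree P} → Q (exec P s) → Halts P s (cost P) Q
straight P s Q {f} q = let (t , d , t≤) = exec-⇓ P s f in exec P s , t , d , t≤ , q

infixr 5 _then_
_then_ : ∀ {P P′ s T T′ Q Q′} → Halts P s T Q → (∀ s′ → Q s′ → Halts P′ s′ T′ Q′) →
         Halts (P ⨾ P′) s (T + T′) Q′
(s′ , t , d , t≤ , q) then k =
  let (s″ , t′ , d′ , t′≤ , q′) = k s′ q
  in s″ , t + t′ , seq⇓ d d′ , +-mono-≤ t≤ t′≤ , q′

-- The measure is an index of the invariant rather than a function of the state, since it involves
-- ghost data such as the unread input. An iteration costs its body and one test; the leading 1 pays
-- for the final test.
loop : ∀ b P (I : ℕ → State → Set) {f : LoopFree P} →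
       (∀ {m s} → I m s → test b s ≡ true → ∃[ m′ ] m′ < m × I m′ (exec P s)) →
       ∀ M {m s} → m ≤ M → I m s →
       Halts (while b P) s (1 + M * suc (cost P))
             (λ s′ → test b s′ ≡ false × ∃[ m′ ] I m′ s′)
loop b P I {f} step M {m} {s} m≤M i with test b s in eq
... | false = s , 1 , done⇓ eq , s≤s z≤n , eq , m , i
loop b P I {f} step M {m} {s} m≤M i | true with step i eq
loop b P I {f} step zero m≤M i | true | m′ , m′<m , _ =
  contradiction (≤-trans m′<m m≤M) λ ()
loop b P I {f} step (suc M) {m} {s} m≤M i | true | m′ , m′<m , i′ =
  let (t , d , t≤) = exec-⇓ P s f
      (s′ , t′ , d′ , t′≤ , q) = loop b P I {f} step M (≤-pred (≤-trans m′<m m≤M)) i′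
  in s′ , suc (t + t′) , loop⇓ eq d d′ ,
     s≤s (≤-trans (+-mono-≤ t≤ t′≤)
       (≤-reflexive (+-suc (cost P) (M * suc (cost P))))) , q

branch : ∀ b P P′ s (C : State → Set) →
         (test b s ≡ true → C (exec P s)) → (test b s ≡ false → C (exec P′ s)) →
         C (exec (ifThenElse b P P′) s)
branch b P P′ s C c c′ with test b s in eq
... | true  = c refl
... | false = c′ refl

-- Frame conditions: registers and arrays that a program never writes.

KeepsReg : Reg → Program → Set
KeepsReg x (const y _)         = T (not (x ≡ᵇ y))
KeepsReg x (copy y _)          = T (not (x ≡ᵇ y))
KeepsReg x (inc y)             = T (not (x ≡ᵇ y))
KeepsReg x (dec y)             = T (not (x ≡ᵇ y))
KeepsReg x (load y _ _)        = T (not (x ≡ᵇ y))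
KeepsReg x (P ⨾ P′)            = KeepsReg x P × KeepsReg x P′
KeepsReg x (ifThenElse _ P P′) = KeepsReg x P × KeepsReg x P′
KeepsReg _ _                   = ⊤

KeepsArr : Arr → Program → Set
KeepsArr a (store b _ _)       = T (not (a ≡ᵇ b))
KeepsArr a (P ⨾ P′)            = KeepsArr a P × KeepsArr a P′
KeepsArr a (ifThenElse _ P P′) = KeepsArr a P × KeepsArr a P′
KeepsArr _ _                   = ⊤

update-skip : ∀ {B : Set} (f : ℕ → B) i {v} j → T (not (j ≡ᵇ i)) → update f i v j ≡ f j
update-skip f i j ne with j ≡ᵇ i
... | false = refl

update-same : ∀ {B : Set} (f : ℕ → B) i {v j} → j ≡ i → update f i v j ≡ v
update-same f i {j = j} j≡i with j ≡ᵇ i in eq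
... | true  = refl
... | false = Empty.⊥-elim (subst T eq (≡⇒≡ᵇ j i j≡i))

update-other : ∀ {B : Set} (f : ℕ → B) i {v j} → j ≢ i → update f i v j ≡ f j
update-other f i {j = j} j≢i with j ≡ᵇ i in eq
... | false = refl
... | true  = contradiction (≡ᵇ⇒≡ j i (subst T (sym eq) tt)) j≢i

-- A conditional on an open state does not reduce, so preservation across `tryPush` or `strike`
-- cannot be left to computation and is read off the syntax.
keeps-reg : ∀ x P s {_ : KeepsReg x P} → reg (exec P s) x ≡ reg s x
keeps-reg x skip          s     = refl
keeps-reg x (const y _)   s {k} = update-skip (reg s) y x k
keeps-reg x (copy y _)    s {k} = update-skip (reg s) y x k
keeps-reg x (inc y)       s {k} = update-skip (reg s) y x k
keeps-reg x (dec y)       s {k} = update-skip (reg s) y x k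
keeps-reg x (load y _ _)  s {k} = update-skip (reg s) y x k
keeps-reg x (store _ _ _) s     = refl
keeps-reg x (P ⨾ P′)      s {k , k′} =
  trans (keeps-reg x P′ (exec P s) {k′}) (keeps-reg x P s {k})
keeps-reg x (ifThenElse b P P′) s {k , k′} with test b s
... | true  = keeps-reg x P s {k}
... | false = keeps-reg x P′ s {k′}
keeps-reg x (while _ _)   s     = refl

keeps-arr : ∀ a P s {_ : KeepsArr a P} → arr (exec P s) a ≡ arr s a
keeps-arr a skip          s     = refl
keeps-arr a (const _ _)   s     = refl
keeps-arr a (copy _ _)    s     = refl
keeps-arr a (inc _)       s     = refl
keeps-arr a (dec _)       s     = refl
keeps-arr a (load _ _ _)  s     = refl
keeps-arr a (store b _ _) s {k} = update-skip (arr s) b a k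
keeps-arr a (P ⨾ P′)      s {k , k′} =
  trans (keeps-arr a P′ (exec P s) {k′}) (keeps-arr a P s {k})
keeps-arr a (ifThenElse b P P′) s {k , k′} with test b s
... | true  = keeps-arr a P s {k}
... | false = keeps-arr a P′ s {k′}
keeps-arr a (while _ _)   s     = refl

less-true : ∀ {x y s} → test (less x y) s ≡ true → reg s x < reg s y
less-true {x} {y} {s} eq = <ᵇ⇒< (reg s x) (reg s y) (subst T (sym eq) tt)

less-false : ∀ {x y s} → test (less x y) s ≡ false → reg s y ≤ reg s x
less-false {x} {y} {s} eq = ≮⇒≥ λ x<y → subst T eq (<⇒<ᵇ x<y)

equal-true : ∀ {x y s} → test (equal x y) s ≡ true → reg s x ≡ reg s y
equal-true {x} {y} {s} eq = ≡ᵇ⇒≡ (reg s x) (reg s y) (subst T (sym eq) tt)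

equal-false : ∀ {x y s} → test (equal x y) s ≡ false → reg s x ≢ reg s y
equal-false {x} {y} {s} eq x≡y = subst T eq (≡⇒≡ᵇ (reg s x) (reg s y) x≡y)

-- Subsets, rules and linked lists of occurrences

∣p∪⁅x⁆∣≡1+∣p∣ : ∀ {n} (p : Subset n) x → x ∉ p → ∣ p ∪ ⁅ x ⁆ ∣ ≡ suc ∣ p ∣
∣p∪⁅x⁆∣≡1+∣p∣ (inside  ∷ p) zero x∉p = contradiction here x∉p
∣p∪⁅x⁆∣≡1+∣p∣ (outside ∷ p) zero x∉p = cong (λ r → suc ∣ r ∣) (∪-identityʳ p)
∣p∪⁅x⁆∣≡1+∣p∣ (inside  ∷ p) (suc x) x∉p =
  cong suc (∣p∪⁅x⁆∣≡1+∣p∣ p x λ x∈p → x∉p (there x∈p))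
∣p∪⁅x⁆∣≡1+∣p∣ (outside ∷ p) (suc x) x∉p = ∣p∪⁅x⁆∣≡1+∣p∣ p x λ x∈p → x∉p (there x∈p)

x∈p─q⇒x∉q : ∀ {n} {x : Fin n} (p q : Subset n) → x ∈ p ─ q → x ∉ q
x∈p─q⇒x∉q (_ ∷ p) (outside ∷ q) here      = λ ()
x∈p─q⇒x∉q (_ ∷ p) (_ ∷ q) (there x∈) (there x∈q) = x∈p─q⇒x∉q p q x∈ x∈q

[p∪⁅x⁆]─p≡⁅x⁆ : ∀ {n} (p : Subset n) x → x ∉ p → (p ∪ ⁅ x ⁆) ─ p ≡ ⁅ x ⁆
[p∪⁅x⁆]─p≡⁅x⁆ p x x∉p = ⊆-antisym to from
  where
  to : (p ∪ ⁅ x ⁆) ─ p ⊆ ⁅ x ⁆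
  to y∈ with x∈p∪q⁻ p ⁅ x ⁆ (p─q⊆p (p ∪ ⁅ x ⁆) p y∈)
  ... | inj₁ y∈p = contradiction y∈p (x∈p─q⇒x∉q (p ∪ ⁅ x ⁆) p y∈)
  ... | inj₂ y∈x = y∈x
  from : ⁅ x ⁆ ⊆ (p ∪ ⁅ x ⁆) ─ p
  from y∈x with refl ← x∈⁅y⁆⇒x≡y x y∈x =
    x∈p∧x∉q⇒x∈p─q (q⊆p∪q p ⁅ x ⁆ y∈x) x∉p

∣p∣≡1⇒unique : ∀ {n} {p : Subset n} {x y} → ∣ p ∣ ≡ 1 → x ∈ p → y ∈ p → x ≡ y
∣p∣≡1⇒unique {p = p} {x} {y} ∣p∣≡1 x∈p y∈p with x Fin.≟ y
... | yes x≡y = x≡y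
... | no  x≢y = contradiction
  (subst (2 ≤_) ∣p∣≡1 (≤-trans (s≤s (x∈p⇒0<∣p∣ y∈p-x)) (x∈p⇒∣p-x∣<∣p∣ x∈p)))
  λ { (s≤s ()) }
  where
  y∈p-x : y ∈ p - x
  y∈p-x = x∈p∧x≢y⇒x∈p-y y∈p λ y≡x → x≢y (sym y≡x)
  x∈p⇒0<∣p∣ : ∀ {n} {p : Subset n} {x} → x ∈ p → 0 < ∣ p ∣
  x∈p⇒0<∣p∣ x∈p = ≤-trans (s≤s z≤n) (x∈p⇒∣p-x∣<∣p∣ x∈p)

p⊆q∧∣p∣≡∣q∣⇒p≡q : ∀ {n} {p q : Subset n} → p ⊆ q → ∣ p ∣ ≡ ∣ q ∣ → p ≡ q
p⊆q∧∣p∣≡∣q∣⇒p≡q {p = p} {q} p⊆q ∣p∣≡∣q∣ = ⊆-antisym p⊆q q⊆p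
  where
  q⊆p : q ⊆ p
  q⊆p {x} x∈q with x ∈? p
  ... | yes x∈p = x∈p
  ... | no  x∉p = contradiction (p⊂q⇒∣p∣<∣q∣ (p⊆q , x , x∈q , x∉p)) (<-irrefl ∣p∣≡∣q∣)

fromList : ∀ {n} → List (Fin n) → Subset n
fromList []       = ⊥
fromList (x ∷ xs) = fromList xs ∪ ⁅ x ⁆

∈-fromList⁺ : ∀ {n} {x : Fin n} {xs} → x ∈ₗ xs → x ∈ fromList xs
∈-fromList⁺ {xs = y ∷ ys} (here refl) = q⊆p∪q (fromList ys) ⁅ y ⁆ (x∈⁅x⁆ y)
∈-fromList⁺ {xs = y ∷ ys} (there x∈)  = p⊆p∪q ⁅ y ⁆ (∈-fromList⁺ x∈)

∈-fromList⁻ : ∀ {n} {x : Fin n} xs → x ∈ fromList xs → x ∈ₗ xs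
∈-fromList⁻ []       x∈ = contradiction x∈ ∉⊥
∈-fromList⁻ (y ∷ ys) x∈ with x∈p∪q⁻ (fromList ys) ⁅ y ⁆ x∈
... | inj₁ x∈ys = there (∈-fromList⁻ ys x∈ys)
... | inj₂ x∈y  = here (x∈⁅y⁆⇒x≡y y x∈y)

∣fromList∣ : ∀ {n} {xs : List (Fin n)} → Unique xs → ∣ fromList xs ∣ ≡ length xs
∣fromList∣ {n} {[]}     []       = ∣⊥∣≡0 n
∣fromList∣ {n} {x ∷ xs} (x∉ ∷ u) =
  trans (∣p∪⁅x⁆∣≡1+∣p∣ (fromList xs) x
          λ x∈ → All.lookup x∉ (∈-fromList⁻ xs x∈) refl)
        (cong suc (∣fromList∣ u))

-- The machine sees list lengths while `ℓ` counts subsets; `fromList` turns the enumeration into a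
-- subset of the same size, which extensionality identifies with `A`.
length-Lists : ∀ {n} {xs : List (Fin n)} {A} → Lists xs A → length xs ≡ ∣ A ∣
length-Lists {xs = xs} {A} (u , h) = trans (sym (∣fromList∣ u)) (cong ∣_∣ (⊆-antisym
  (λ x∈ → Equivalence.to (h _) (∈-fromList⁻ xs x∈))
  (λ x∈ → ∈-fromList⁺ (Equivalence.from (h _) x∈))))

TightPath-map : ∀ {n} {𝓕 𝓖 : Subset n → Set} {Y Z} → (∀ {W} → 𝓕 W → 𝓖 W) →
                TightPath 𝓕 Y Z → TightPath 𝓖 Y Z
TightPath-map f (start k)            = start (f k)
TightPath-map f (extend p k Y⊆Z one) = extend (TightPath-map f p) (f k) Y⊆Z one

path-end : ∀ {n} {𝓕 : Subset n → Set} {Y Z} → TightPath 𝓕 Y Z → 𝓕 Z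
path-end (start k)        = k
path-end (extend _ k _ _) = k

-- A placed rule is a rule together with the address of its header in the input.
Placed : ℕ → Set
Placed n = ℕ × Rule n

weight : ∀ {n} → (ℕ → ℕ) → Fin n → Placed n → ℕ
weight hit q (j , A , q′) with q Fin.≟ q′ | hit j
... | yes _ | zero  = 1
... | yes _ | suc _ = 0
... | no  _ | _     = 0

-- The intended value of `cnt[q]`.
unhit : ∀ {n} → (ℕ → ℕ) → Fin n → List (Placed n) → ℕ
unhit hit q G = sum (map (weight hit q) G)

weight-cong : ∀ {n} (hit hit′ : ℕ → ℕ) (q : Fin n) g →
              hit (proj₁ g) ≡ hit′ (proj₁ g) → weight hit q g ≡ weight hit′ q g
weight-cong hit hit′ q (j , A , q′) eq with q Fin.≟ q′ | hit j | hit′ j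
... | yes _ | zero  | zero  = refl
... | yes _ | suc _ | suc _ = refl
... | no  _ | _     | _     = refl

unhit-cong : ∀ {n} (hit hit′ : ℕ → ℕ) (q : Fin n) {G} →
             All (λ g → hit (proj₁ g) ≡ hit′ (proj₁ g)) G → unhit hit q G ≡ unhit hit′ q G
unhit-cong hit hit′ q {[]}    []         = refl
unhit-cong hit hit′ q {g ∷ _} (eq ∷ eqs) =
  cong₂ _+_ (weight-cong hit hit′ q g eq) (unhit-cong hit hit′ q eqs)

weight-unhit : ∀ {n} (hit : ℕ → ℕ) {q q′ : Fin n} {j A} →
               q ≡ q′ → hit j ≡ 0 → weight hit q (j , A , q′) ≡ 1
weight-unhit hit {q} {q′} {j} q≡q′ eq with q Fin.≟ q′ | hit j
... | yes _    | zero = refl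
... | no  q≢q′ | _    = contradiction q≡q′ q≢q′

weight-hit : ∀ {n} (hit : ℕ → ℕ) {q q′ : Fin n} {j A} →
             hit j ≢ 0 → weight hit q (j , A , q′) ≡ 0
weight-hit hit {q} {q′} {j} ne with q Fin.≟ q′ | hit j
... | yes _ | zero  = contradiction refl ne
... | yes _ | suc _ = refl
... | no  _ | _     = refl

weight-other : ∀ {n} (hit : ℕ → ℕ) {q q′ : Fin n} {j A} →
               q ≢ q′ → weight hit q (j , A , q′) ≡ 0
weight-other hit {q} {q′} {j} ne with q Fin.≟ q′ | hit j
... | yes q≡q′ | _     = contradiction q≡q′ ne
... | no  _    | _     = refl

unhit≡0⇒hit : ∀ {n} (hit : ℕ → ℕ) {q : Fin n} {j A G} →
              unhit hit q G ≡ 0 → (j , A , q) ∈ₗ G → hit j ≢ 0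
unhit≡0⇒hit hit {q} {j} {A} eq (here refl) hj≡0 =
  contradiction (trans (sym (weight-unhit hit {q} {q} {j} {A} refl hj≡0))
    (m+n≡0⇒m≡0 _ eq)) λ ()
unhit≡0⇒hit hit {q} {G = g ∷ G} eq (there g∈) =
  unhit≡0⇒hit hit (m+n≡0⇒n≡0 (weight hit q g) eq) g∈

unhit≢0⇒∃ : ∀ {n} (hit : ℕ → ℕ) (q : Fin n) G → unhit hit q G ≢ 0 →
            ∃[ j ] ∃[ A ] (j , A , q) ∈ₗ G × hit j ≡ 0
unhit≢0⇒∃ hit q [] ne = contradiction refl ne
unhit≢0⇒∃ hit q ((j , A , q′) ∷ G) ne with q Fin.≟ q′ | hit j in eq
... | yes refl | zero  = j , A , here refl , eq
... | yes _    | suc _ = let (j , A , g∈ , eq) = unhit≢0⇒∃ hit q G ne in j , A , there g∈ , eq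
... | no  _    | _     = let (j , A , g∈ , eq) = unhit≢0⇒∃ hit q G ne in j , A , there g∈ , eq

module _ {n : ℕ} (hit : ℕ → ℕ) (j v : ℕ) where
  private
    hit′ : ℕ → ℕ
    hit′ = update hit j v

  unhit-fresh : ∀ q {G : List (Placed n)} → All (λ i → j ≢ i) (map proj₁ G) →
                unhit hit q G ≡ unhit hit′ q G
  unhit-fresh q j∉ =
    unhit-cong hit _ q (All.map (λ j≢i → sym (update-other hit j λ i≡j → j≢i (sym i≡j)))
                                (All.map⁻ j∉))

  unhit-update-other : ∀ {q q′ : Fin n} {A G} → Unique (map proj₁ G) → (j , A , q) ∈ₗ G →
                       q′ ≢ q → unhit hit q′ G ≡ unhit hit′ q′ G
  unhit-update-other {q} {q′} {A} (j∉ ∷ u) (here refl) ne =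
    cong₂ _+_ (trans (weight-other hit {j = j} {A} ne) (sym (weight-other hit′ {j = j} {A} ne)))
      (unhit-fresh q′ j∉)
  unhit-update-other {q} {q′} (i∉ ∷ u) (there {x = g} g∈) ne =
    cong₂ _+_ (weight-cong hit hit′ q′ g
                (sym (update-other hit j (All.lookup i∉ (∈-map⁺ proj₁ g∈)))))
      (unhit-update-other u g∈ ne)

  -- Header addresses are distinct, so exactly one summand changes, from 1 to 0. The single `dec` in
  -- `markHit` relies on this.
  unhit-update-same : ∀ {q : Fin n} {A G} → Unique (map proj₁ G) → (j , A , q) ∈ₗ G →
                      v ≢ 0 → hit j ≡ 0 → unhit hit q G ≡ suc (unhit hit′ q G)
  unhit-update-same {q} {A} {_ ∷ G} (j∉ ∷ u) (here refl) v≢0 hj≡0 =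
    cong₂ _+_ (weight-unhit hit {q} {q} {j} {A} refl hj≡0)
      (trans (unhit-fresh q j∉)
        (cong (_+ unhit hit′ q G) (sym (weight-hit hit′ {q} {q} {j} {A} λ eq →
          v≢0 (trans (sym (update-same hit j refl)) eq)))))
  unhit-update-same {q} {G = g ∷ G} (i∉ ∷ u) (there g∈) v≢0 hj≡0 =
    trans (cong₂ _+_ (weight-cong hit hit′ q g
                       (sym (update-other hit j (All.lookup i∉ (∈-map⁺ proj₁ g∈)))))
                     (unhit-update-same u g∈ v≢0 hj≡0))
          (+-suc (weight hit′ q g) _)

-- An occurrence stores only a header address; this recovers the members and the head from it.
placed-unique : ∀ {n} {G : List (Placed n)} {g g′} → Unique (map proj₁ G) →
                g ∈ₗ G → g′ ∈ₗ G → proj₁ g ≡ proj₁ g′ → g ≡ g′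
placed-unique u        (here refl) (here refl) eq = refl
placed-unique (i∉ ∷ u) (here refl) (there g′∈) eq =
  contradiction eq (All.lookup i∉ (∈-map⁺ proj₁ g′∈))
placed-unique (i∉ ∷ u) (there g∈)  (here refl) eq =
  contradiction (sym eq) (All.lookup i∉ (∈-map⁺ proj₁ g∈))
placed-unique (i∉ ∷ u) (there g∈)  (there g′∈) eq = placed-unique u g∈ g′∈ eq

-- (p , a , j): the input word holds a at address p, as a member of the rule
-- whose header is at address j.
Occurrence : ℕ → Set
Occurrence n = ℕ × Fin n × ℕ

first : ∀ {n} → Fin n → List (Occurrence n) → ℕ
first a []                = 0
first a ((p , b , _) ∷ L) with a Fin.≟ b
... | yes _ = p
... | no  _ = first a L

first-here : ∀ {n} {a b : Fin n} {p j L} → a ≡ b → first a ((p , b , j) ∷ L) ≡ p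
first-here {a = a} {b} a≡b with a Fin.≟ b
... | yes _   = refl
... | no  a≢b = contradiction a≡b a≢b

first-there : ∀ {n} {a b : Fin n} {p j L} → a ≢ b → first a ((p , b , j) ∷ L) ≡ first a L
first-there {a = a} {b} a≢b with a Fin.≟ b
... | yes a≡b = contradiction a≡b a≢b
... | no  _   = refl

-- All linked lists are threaded through one ghost list `L`: the list of `a` is the subsequence of
-- its occurrences, so `next` leads to the first occurrence of the same element in the tail.
data Linked {n} (next owner : ℕ → ℕ) : List (Occurrence n) → Set where
  []   : Linked next owner []
  link : ∀ {p a j L} → 0 < p → next p ≡ first a L → owner p ≡ j →
         Linked next owner L → Linked next owner ((p , a , j) ∷ L)

Linked-cong : ∀ {n} {next owner next′ owner′} {L : List (Occurrence n)} →
              All (λ o → next′ (proj₁ o) ≡ next (proj₁ o)) L →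
              All (λ o → owner′ (proj₁ o) ≡ owner (proj₁ o)) L →
              Linked next owner L → Linked next′ owner′ L
Linked-cong []         []         []                   = []
Linked-cong (ne ∷ nes) (oe ∷ oes) (link 0<p nx ow lnk) =
  link 0<p (trans ne nx) (trans oe ow) (Linked-cong nes oes lnk)

first≡0⇒∉ : ∀ {n next owner} {a : Fin n} {L} → Linked next owner L → first a L ≡ 0 →
            ∀ {p j} → ¬ (p , a , j) ∈ₗ L
first≡0⇒∉ {a = a} (link {j = j} {L} 0<p _ _ _) eq (here refl) = contradiction (trans (sym eq) (first-here {a = a} {a} {j = j} {L} refl)) (<⇒≢ 0<p)
first≡0⇒∉ {a = a} (link {a = b} 0<p _ _ lnk) eq (there o∈) with a Fin.≟ b
... | yes _ = contradiction (sym eq) (<⇒≢ 0<p)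
... | no  _ = first≡0⇒∉ lnk eq o∈

record Unlinked {n} (next owner : ℕ → ℕ) (a : Fin n) (p : ℕ) (L : List (Occurrence n)) : Set where
  field
    rest       : List (Occurrence n)
    occurs     : (p , a , owner p) ∈ₗ L
    next-first : next p ≡ first a rest
    first-rest : ∀ {b} → b ≢ a → first b rest ≡ first b L
    linked     : Linked next owner rest
    length-rest : length L ≡ suc (length rest)
    split      : ∀ {o} → o ∈ₗ L → o ≡ (p , a , owner p) ⊎ o ∈ₗ rest
    rest⊆      : ∀ {o} → o ∈ₗ rest → o ∈ₗ L

-- Every cell in front of the first occurrence of `a` belongs to another element, so its `next`
-- pointer never leads to the removed cell. Hence the remaining cells stay as they are, and only
-- `hd[a]` has to be updated.
unlink : ∀ {n next owner} (a : Fin n) {L} → Linked next owner L → first a L ≢ 0 →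
         Unlinked next owner a (first a L) L
unlink a [] ne = contradiction refl ne
unlink {next = next} {owner} a (link {p} {b} {j} {L} 0<p nx ow lnk) ne with a Fin.≟ b
... | yes refl = record
  { rest = L
  ; occurs = here (cong (λ i → p , a , i) ow)
  ; next-first = nx
  ; first-rest = λ b≢a → sym (first-there {j = j} {L} b≢a)
  ; linked = lnk
  ; length-rest = refl
  ; split = λ { (here refl) → inj₁ (cong (λ i → p , a , i) (sym ow)) ; (there o∈) → inj₂ o∈ }
  ; rest⊆ = there
  }
... | no a≢b = record
  { rest = (p , b , j) ∷ U.rest
  ; occurs = there U.occurs
  ; next-first = trans U.next-first (sym (first-there {j = j} {U.rest} a≢b))
  ; first-rest = first-rest
  ; linked = link 0<p (trans nx (sym (U.first-rest λ b≡a → a≢b (sym b≡a)))) ow U.linked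
  ; length-rest = cong suc U.length-rest
  ; split = λ { (here refl) → inj₂ (here refl)
              ; (there o∈) → map₂ there (U.split o∈) }
  ; rest⊆ = λ { (here refl) → here refl ; (there o∈) → there (U.rest⊆ o∈) }
  }
  where
  module U = Unlinked (unlink a lnk ne)
  first-rest : ∀ {c} → c ≢ a → first c ((p , b , j) ∷ U.rest) ≡ first c ((p , b , j) ∷ L)
  first-rest {c} c≢a with c Fin.≟ b
  ... | yes _ = refl
  ... | no  _ = U.first-rest c≢a

-- Hitting a rule

rzero rone rpos rleft rrules rrem rhead ra rp rnext rj rhit rq rcnt rin rqh rqt rsize : Reg
rzero  = 1
rone   = 2
rpos   = 3
rleft  = 4
rrules = 5
rrem   = 6
rhead  = 7
ra     = 8
rp     = 9
rnext  = 10
rj     = 11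
rhit   = 12
rq     = 13
rcnt   = 14
rin    = 15
rqh    = 16
rqt    = 17
rsize  = 18

-- hd[a] is the address of the first unprocessed occurrence of a and next[p] that
-- of the one after p; 0 ends a list, as no occurrence has address 0.  owner[p] is
-- the header address of the rule containing p, and hit is indexed by headers.
input inX cnt hd next owner hit queue : Arr
input = 0
inX   = 1
cnt   = 2
hd    = 3
next  = 4
owner = 5
hit   = 6
queue = 7

-- Marks are 0 or 1, so the single test `cnt[q] < inX[q]` says that `q` is marked and has no unhit
-- rule. A header address holds the head itself, whence `load rq input rj`.
push tryPush markHit strike : Program
push    = store queue rqt rq ⨾ inc rqt
tryPush = load rcnt cnt rq ⨾ load rin inX rq ⨾ ifThenElse (less rcnt rin) push skip
markHit =
  store hit rj rone ⨾ load rq input rj ⨾ load rcnt cnt rq ⨾ dec rcnt ⨾ store cnt rq rcnt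
strike  = load rhit hit rj ⨾ ifThenElse (equal rhit rzero) (markHit ⨾ tryPush) skip

-- This is the part of the state that `Core` depends on. Writes to other registers leave `view`
-- definitionally unchanged, so a proof of `Core` survives them as it stands.
record Memory : Set where
  field
    inputᵐ inXᵐ cntᵐ hitᵐ queueᵐ : ℕ → ℕ
    zeroᵐ oneᵐ qtᵐ : ℕ
open Memory

view : State → Memory
view s = record
  { inputᵐ = arr s input ; inXᵐ = arr s inX ; cntᵐ = arr s cnt ; hitᵐ = arr s hit
  ; queueᵐ = arr s queue ; zeroᵐ = reg s rzero ; oneᵐ = reg s rone ; qtᵐ = reg s rqt }

-- X is the set of marked elements and Y the set of queued ones.
record Core {n} (X Y : Subset n) (G : List (Placed n)) (M : Memory) : Set where
  field
    zero-const : zeroᵐ M ≡ 0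
    one-const  : oneᵐ M ≡ 1
    distinct   : Unique (map proj₁ G)
    headers    : ∀ {j A q} → (j , A , q) ∈ₗ G → inputᵐ M j ≡ toℕ q
    counts     : ∀ q → cntᵐ M (toℕ q) ≡ unhit (hitᵐ M) q G
    hits       : ∀ {j A q} → (j , A , q) ∈ₗ G → hitᵐ M j ≢ 0 →
                 ∃[ a ] a ∈ A × a ∈ Y ∪ ⁅ q ⁆
    marked     : ∀ {q} → q ∈ X → inXᵐ M (toℕ q) ≡ 1
    unmarked   : ∀ {q} → q ∉ X → inXᵐ M (toℕ q) ≡ 0
    Y⊆X        : Y ⊆ X
    settled    : ∀ {q} → q ∈ Y → unhit (hitᵐ M) q G ≡ 0
    path       : TightPath (𝒦 (map proj₂ G)) ⊥ Y
    size       : qtᵐ M ≡ ∣ Y ∣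
    queued     : ∀ {y} → y ∈ Y → ∃[ i ] i < qtᵐ M × queueᵐ M i ≡ toℕ y
    in-queue   : ∀ {i} → i < qtᵐ M → ∃[ y ] y ∈ Y × queueᵐ M i ≡ toℕ y

-- Greediness: no eligible element is left out of the queue. It is kept apart from `Core` because it
-- may fail between a counter update or a marking and the `tryPush` that follows.
Closed : ∀ {n} (X Y : Subset n) → List (Placed n) → (ℕ → ℕ) → Set
Closed X Y G hits = ∀ {q} → q ∈ X → unhit hits q G ≡ 0 → q ∈ Y

record Pushed {n} (X Y : Subset n) (G : List (Placed n)) (M M′ : Memory) : Set where
  field
    Y′     : Subset n
    core   : Core X Y′ G M′
    closed : Closed X Y′ G (hitᵐ M′)
    prefix : ∀ {i} → i < qtᵐ M → queueᵐ M′ i ≡ queueᵐ M i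

-- Its two callers have just lowered the counter of `q₀` or just marked `q₀`, so closedness can fail
-- at `q₀` only.
tryPush-correct : ∀ {n} {X Y : Subset n} {G} s {q₀} → Core X Y G (view s) →
  reg s rq ≡ toℕ q₀ → q₀ ∉ Y →
  (∀ {q} → q ∈ X → q ≢ q₀ → unhit (arr s hit) q G ≡ 0 → q ∈ Y) →
  Pushed X Y G (view s) (view (exec tryPush s))
tryPush-correct {n} {X} {Y} {G} s {q₀} c rq≡ q₀∉Y almost =
  branch (less rcnt rin) push skip s₁ (λ s′ → Pushed X Y G (view s) (view s′))
    (λ lt → pushed (less-true {rcnt} {rin} {s₁} lt))
    (λ ge → kept (less-false {rcnt} {rin} {s₁} ge))
  where
  open Core c
  s₁ : State
  s₁ = exec (load rcnt cnt rq ⨾ load rin inX rq) s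
  cnt≡ : arr s cnt (reg s rq) ≡ unhit (arr s hit) q₀ G
  cnt≡ = trans (cong (arr s cnt) rq≡) (counts q₀)
  in≡ : arr s inX (reg s rq) ≡ arr s inX (toℕ q₀)
  in≡ = cong (arr s inX) rq≡

  pushed : arr s cnt (reg s rq) < arr s inX (reg s rq) →
           Pushed X Y G (view s) (view (exec push s₁))
  pushed lt = record
    { Y′ = Y ∪ ⁅ q₀ ⁆
    ; core = record
      { zero-const = zero-const ; one-const = one-const ; distinct = distinct
      ; headers = headers ; counts = counts
      ; hits = λ g∈ ne → let (a , a∈A , a∈) = hits g∈ ne in a , a∈A , widen a∈
      ; marked = marked ; unmarked = unmarked
      ; Y⊆X = λ q∈ → old-or-new (_∈ X) Y⊆X q₀∈X q∈
      ; settled = λ {q} q∈ → old-or-new (λ q → unhit (arr s hit) q G ≡ 0) settled none q∈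
      ; path = extend path accepted Y⊆Y′
          (trans (cong ∣_∣ ([p∪⁅x⁆]─p≡⁅x⁆ Y q₀ q₀∉Y)) (∣⁅x⁆∣≡1 q₀))
      ; size = trans (cong suc size) (sym (∣p∪⁅x⁆∣≡1+∣p∣ Y q₀ q₀∉Y))
      ; queued = λ y∈ → old-or-new
          (λ y → ∃[ i ] i < suc qt × queue′ i ≡ toℕ y)
          (λ y∈Y → let (i , i<qt , eq) = queued y∈Y in
             i , m<n⇒m<1+n i<qt , trans (prefix i<qt) eq)
          (qt , n<1+n qt , trans (update-same (arr s queue) qt refl) rq≡) y∈
      ; in-queue = in-queue′
      }
    ; closed = closed
    ; prefix = prefix
    }
    where
    qt : ℕ
    qt = reg s rqt
    queue′ : ℕ → ℕ
    queue′ = update (arr s queue) qt (reg s rq)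
    Y⊆Y′ : Y ⊆ Y ∪ ⁅ q₀ ⁆
    Y⊆Y′ = p⊆p∪q ⁅ q₀ ⁆
    q₀∈Y′ : q₀ ∈ Y ∪ ⁅ q₀ ⁆
    q₀∈Y′ = q⊆p∪q Y ⁅ q₀ ⁆ (x∈⁅x⁆ q₀)
    old-or-new : (P : Fin n → Set) → (∀ {q} → q ∈ Y → P q) → P q₀ →
                 ∀ {q} → q ∈ Y ∪ ⁅ q₀ ⁆ → P q
    old-or-new P old new q∈ with x∈p∪q⁻ Y ⁅ q₀ ⁆ q∈
    ... | inj₁ q∈Y  = old q∈Y
    ... | inj₂ q∈q₀ = subst P (sym (x∈⁅y⁆⇒x≡y q₀ q∈q₀)) new
    q₀∈X : q₀ ∈ X
    q₀∈X with q₀ ∈? X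
    ... | yes q₀∈ = q₀∈
    ... | no  q₀∉ = contradiction (subst (arr s cnt (reg s rq) <_) (trans in≡ (unmarked q₀∉)) lt) n≮0
    none : unhit (arr s hit) q₀ G ≡ 0
    none = trans (sym cnt≡) (n<1⇒n≡0 (subst (arr s cnt (reg s rq) <_) (trans in≡ (marked q₀∈X)) lt))
    widen : ∀ {a q} → a ∈ Y ∪ ⁅ q ⁆ → a ∈ (Y ∪ ⁅ q₀ ⁆) ∪ ⁅ q ⁆
    widen {q = q} a∈ with x∈p∪q⁻ Y ⁅ q ⁆ a∈
    ... | inj₁ a∈Y = p⊆p∪q ⁅ q ⁆ (Y⊆Y′ a∈Y)
    ... | inj₂ a∈q = q⊆p∪q (Y ∪ ⁅ q₀ ⁆) ⁅ q ⁆ a∈q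
    -- Only rules with head in the new set matter; their counters are 0, so each is hit. A rule hit
    -- by its own head `q` is accepted too, as `q` itself lies in the new set.
    accepted : 𝒦 (map proj₂ G) (Y ∪ ⁅ q₀ ⁆)
    accepted = All.map⁺ (All.tabulate λ { {j , A , q} g∈ q∈ →
      let (a , a∈A , a∈) = hits g∈ (unhit≡0⇒hit (arr s hit)
            (old-or-new (λ q → unhit (arr s hit) q G ≡ 0) settled none q∈) g∈)
      in a , x∈p∩q⁺ (absorb q∈ a∈ , a∈A) })
      where
      absorb : ∀ {a q} → q ∈ Y ∪ ⁅ q₀ ⁆ → a ∈ Y ∪ ⁅ q ⁆ → a ∈ Y ∪ ⁅ q₀ ⁆
      absorb {q = q} q∈ a∈ with x∈p∪q⁻ Y ⁅ q ⁆ a∈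
      ... | inj₁ a∈Y = Y⊆Y′ a∈Y
      ... | inj₂ a∈q = subst (_∈ Y ∪ ⁅ q₀ ⁆) (sym (x∈⁅y⁆⇒x≡y q a∈q)) q∈
    prefix : ∀ {i} → i < qt → queue′ i ≡ arr s queue i
    prefix i<qt = update-other (arr s queue) qt (<⇒≢ i<qt)
    in-queue′ : ∀ {i} → i < suc qt → ∃[ y ] y ∈ Y ∪ ⁅ q₀ ⁆ × queue′ i ≡ toℕ y
    in-queue′ {i} i≤qt with m<1+n⇒m<n∨m≡n i≤qt
    ... | inj₁ i<qt = let (y , y∈ , eq) = in-queue i<qt in
                      y , Y⊆Y′ y∈ , trans (prefix i<qt) eq
    ... | inj₂ refl = q₀ , q₀∈Y′ , trans (update-same (arr s queue) qt refl) rq≡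
    closed : Closed X (Y ∪ ⁅ q₀ ⁆) G (arr s hit)
    closed {q} q∈X eq with q Fin.≟ q₀
    ... | yes refl = q₀∈Y′
    ... | no  q≢q₀ = Y⊆Y′ (almost q∈X q≢q₀ eq)

  kept : arr s inX (reg s rq) ≤ arr s cnt (reg s rq) →
         Pushed X Y G (view s) (view s₁)
  kept ge = record
    { Y′ = Y ; core = c ; closed = closed ; prefix = λ _ → refl }
    where
    closed : Closed X Y G (arr s hit)
    closed {q} q∈X eq with q Fin.≟ q₀
    ... | yes refl = contradiction
                       (subst₂ _≤_ (trans in≡ (marked q∈X)) (trans cnt≡ eq) ge) n≮0
    ... | no  q≢q₀ = almost q∈X q≢q₀ eq

record Struck {n} (X Y : Subset n) (G : List (Placed n)) (j : ℕ) (M M′ : Memory) : Set where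
  field
    pushed : Pushed X Y G M M′
    struck : hitᵐ M′ j ≢ 0
    others : ∀ {i} → i ≢ j → hitᵐ M′ i ≡ hitᵐ M i
  open Pushed pushed public
  hit-mono : ∀ {i} → hitᵐ M i ≢ 0 → hitᵐ M′ i ≢ 0
  hit-mono {i} ne with i ℕ.≟ j
  ... | yes refl = struck
  ... | no  i≢j  = λ eq → ne (trans (sym (others i≢j)) eq)

-- The hypothesis `a ∈ Y ∪ ⁅ q₀ ⁆` covers both uses: an element of `Y` at the front of the queue,
-- and a head met among its own members while reading.
strike-correct : ∀ {n} {X Y : Subset n} {G} s {A q₀ a} → Core X Y G (view s) →
  Closed X Y G (arr s hit) → (reg s rj , A , q₀) ∈ₗ G → a ∈ A → a ∈ Y ∪ ⁅ q₀ ⁆ →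
  Struck X Y G (reg s rj) (view s) (view (exec strike s))
strike-correct {n} {X} {Y} {G} s {A} {q₀} {a} c cl g∈ a∈A a∈ =
  branch (equal rhit rzero) (markHit ⨾ tryPush) skip s₁ (λ s′ → Struck X Y G j (view s) (view s′))
    (λ eq → fresh (trans (equal-true {rhit} {rzero} {s₁} eq) zero-const))
    (λ ne → stale (λ eq → equal-false {rhit} {rzero} {s₁} ne (trans eq (sym zero-const))))
  where
  open Core c
  j : ℕ
  j = reg s rj
  s₁ s₂ : State
  s₁ = exec (load rhit hit rj) s
  s₂ = exec markHit s₁

  stale : arr s hit j ≢ 0 → Struck X Y G j (view s) (view s₁)
  stale ne = record
    { pushed = record { Y′ = Y ; core = c ; closed = cl ; prefix = λ _ → refl }
    ; struck = ne ; others = λ _ → refl }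

  fresh : arr s hit j ≡ 0 → Struck X Y G j (view s) (view (exec tryPush s₂))
  fresh hj≡0 = record
    { pushed = record { Y′ = Pushed.Y′ p ; core = Pushed.core p
                      ; closed = Pushed.closed p ; prefix = Pushed.prefix p }
    ; struck = subst (λ h → h j ≢ 0) (sym hit-kept) hit′j≢0
    ; others = λ i≢j → trans (cong-app hit-kept _) (update-other (arr s hit) j i≢j)
    }
    where
    hit′ : ℕ → ℕ
    hit′ = update (arr s hit) j (reg s rone)
    one≢0 : reg s rone ≢ 0
    one≢0 eq = contradiction (trans (sym one-const) eq) λ ()
    hit′j≢0 : hit′ j ≢ 0
    hit′j≢0 eq = one≢0 (trans (sym (update-same (arr s hit) j refl)) eq)
    hit-kept : arr (exec tryPush s₂) hit ≡ hit′
    hit-kept = keeps-arr hit tryPush s₂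
    q≡ : arr s input j ≡ toℕ q₀
    q≡ = headers g∈
    drop : unhit (arr s hit) q₀ G ≡ suc (unhit hit′ q₀ G)
    drop = unhit-update-same (arr s hit) j (reg s rone) distinct g∈ one≢0 hj≡0
    same : ∀ {q} → q ≢ q₀ → unhit (arr s hit) q G ≡ unhit hit′ q G
    same = unhit-update-other (arr s hit) j (reg s rone) distinct g∈
    -- No element is queued twice, although no membership flag is kept: the struck rule was unhit,
    -- so `q₀` had a positive counter, while queued elements have counter 0.
    q₀∉Y : q₀ ∉ Y
    q₀∉Y q₀∈Y = contradiction (trans (sym (settled q₀∈Y)) drop) λ ()
    counts′ : ∀ q → arr s₂ cnt (toℕ q) ≡ unhit hit′ q G
    counts′ q with q Fin.≟ q₀
    ... | yes refl = trans (update-same (arr s cnt) (arr s input j) (sym q≡))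
      (cong pred (trans (trans (cong (arr s cnt) q≡) (counts q₀)) drop))
    ... | no  q≢q₀ = trans (update-other (arr s cnt) (arr s input j)
        λ eq → q≢q₀ (Fin.toℕ-injective (trans eq q≡)))
      (trans (counts q) (same q≢q₀))
    hits′ : ∀ {i B q} → (i , B , q) ∈ₗ G → hit′ i ≢ 0 → ∃[ b ] b ∈ B × b ∈ Y ∪ ⁅ q ⁆
    hits′ {i} g′∈ ne with i ℕ.≟ j
    ... | yes i≡j with refl ← placed-unique distinct g′∈ g∈ i≡j = a , a∈A , a∈
    ... | no  i≢j = hits g′∈ λ eq → ne (trans (update-other (arr s hit) j i≢j) eq)
    core₂ : Core X Y G (view s₂)
    core₂ = record
      { zero-const = zero-const ; one-const = one-const ; distinct = distinct
      ; headers = headers ; counts = counts′ ; hits = hits′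
      ; marked = marked ; unmarked = unmarked ; Y⊆X = Y⊆X
      ; settled = λ q∈Y → trans (sym (same λ { refl → q₀∉Y q∈Y })) (settled q∈Y)
      ; path = path ; size = size ; queued = queued ; in-queue = in-queue }
    p : Pushed X Y G (view s₂) (view (exec tryPush s₂))
    p = tryPush-correct s₂ core₂ q≡ q₀∉Y
          λ q∈X q≢q₀ eq → cl q∈X (trans (same q≢q₀) eq)

-- Reading the rules

openRule linkMember nextMember resumeRule parseStep : Program
openRule   =
  copy rj rpos ⨾ load rhead input rpos ⨾ inc rpos ⨾ load rrem input rpos ⨾ inc rrem ⨾
  inc rpos ⨾ load rcnt cnt rhead ⨾ inc rcnt ⨾ store cnt rhead rcnt
linkMember = load rnext hd ra ⨾ store next rp rnext ⨾ store owner rp rj ⨾ store hd ra rp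
nextMember =
  load ra input rpos ⨾ copy rp rpos ⨾ inc rpos ⨾ ifThenElse (equal ra rhead) strike linkMember
-- The register rrem holds 0 between two rules and one more than the number of
-- unread members inside a rule.
resumeRule = dec rrem ⨾ ifThenElse (equal rrem rzero) (dec rrules) nextMember
parseStep  = ifThenElse (equal rrem rzero) openRule resumeRule

record Pending {n} (Todo : ℕ → Fin n → Set) (G : List (Placed n)) (L : List (Occurrence n))
               (hdᵃ nextᵃ ownerᵃ hitᵃ : ℕ → ℕ) : Set where
  field
    linked  : Linked nextᵃ ownerᵃ L
    lists   : ∀ a → hdᵃ (toℕ a) ≡ first a L
    owned   : ∀ {p a j} → (p , a , j) ∈ₗ L → ∃[ A ] ∃[ q ] (j , A , q) ∈ₗ G × a ∈ A
    covered : ∀ {j A q a} → (j , A , q) ∈ₗ G → a ∈ A →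
              Todo j a ⊎ hitᵃ j ≢ 0 ⊎ (a ≢ q × ∃[ p ] (p , a , j) ∈ₗ L)

PendingIn : ∀ {n} → (ℕ → Fin n → Set) → List (Placed n) → List (Occurrence n) → State → Set
PendingIn Todo G L s = Pending Todo G L (arr s hd) (arr s next) (arr s owner) (arr s hit)

Nothing : ∀ {n} → ℕ → Fin n → Set
Nothing _ _ = Empty.⊥

Suffix : List ℕ → ℕ → List ℕ → Set
Suffix w p v = ∀ i → at w (i + p) ≡ at v i

Suffix-tail : ∀ {w p x v} → Suffix w p (x ∷ v) → Suffix w (suc p) v
Suffix-tail {w} {p} sfx i = trans (cong (at w) (+-suc i p)) (sfx (suc i))

-- The number of parse steps: one to open a rule, one per member and one to close it.
work : ∀ {n} → List (Rule n) → ℕ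
work []            = 0
work ((A , _) ∷ R) = 2 + ∣ A ∣ + work R

record Parsing {n} (w : List ℕ) (R : List (Rule n)) (k : ℕ) (G : List (Placed n))
               (L : List (Occurrence n)) (R′ : List (Rule n))
               (Todo : ℕ → Fin n → Set) (m : ℕ) (s : State) : Set where
  field
    core    : Core ⊥ ⊥ G (view s)
    word    : ∀ i → arr s input i ≡ at w i
    ssize   : reg s rsize ≡ k
    sqh     : reg s rqh ≡ 0
    pos>0   : 0 < reg s rpos
    below   : All (λ g → proj₁ g < reg s rpos) G
    earlier : All (λ o → proj₁ o < reg s rpos) L
    fresh   : ∀ {i} → reg s rpos ≤ i → arr s hit i ≡ 0
    pending : PendingIn Todo G L s
    split   : map proj₂ G ʳ++ R′ ≡ R
    budget  : length L + m ≤ work R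

module _ {n : ℕ} (w : List ℕ) (R : List (Rule n)) (k : ℕ) where

  -- In the `busy` mode `rrules` still counts the open rule, so the loop test stays true until that
  -- rule is closed, even when no further rule follows.
  data ParseInv : ℕ → State → Set where
    idle : ∀ {G L R′ v s} → reg s rrem ≡ 0 → reg s rrules ≡ length R′ →
           EncodesRules R′ v → Suffix w (reg s rpos) v →
           Parsing w R k G L R′ Nothing (work R′) s → ParseInv (work R′) s
    busy : ∀ {G L R′ v s A q xs} →
           reg s rrem ≡ suc (length xs) → reg s rrules ≡ suc (length R′) →
           reg s rhead ≡ toℕ q → (reg s rj , A , q) ∈ₗ G → All (_∈ A) xs →
           EncodesRules R′ v → Suffix w (reg s rpos) (map toℕ xs ++ v) →
           Parsing w R k G L R′ (λ j a → j ≡ reg s rj × a ∈ₗ xs)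
                   (suc (length xs) + work R′) s →
           ParseInv (suc (length xs) + work R′) s

  Progress : ℕ → State → Set
  Progress m s = ∃[ m′ ] m′ < m × ParseInv m′ s

  openRule-correct : ∀ {G L A q R′ xs v} s → reg s rrules ≡ suc (length R′) →
    Lists xs A → EncodesRules R′ v →
    Suffix w (reg s rpos) (toℕ q ∷ block xs ++ v) →
    Parsing w R k G L ((A , q) ∷ R′) Nothing (work ((A , q) ∷ R′)) s →
    Progress (work ((A , q) ∷ R′)) (exec openRule s)
  openRule-correct {G} {L} {A} {q} {R′} {xs} {v} s nr≡ ls enc sfx P =
    suc (length xs) + work R′ , m< ,
    busy (cong suc (trans (word (suc pos)) (sfx 1))) nr≡ head≡ (here refl)
      (All.tabulate λ a∈ → Equivalence.to (proj₂ ls _) a∈) enc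
      (Suffix-tail {w} (Suffix-tail {w} sfx)) record
      { core = record
        { zero-const = zero-const ; one-const = one-const
        ; distinct = All.map⁺ (All.map (λ g< eq → <⇒≢ g< (sym eq)) below) ∷ distinct
        ; headers = λ { (here refl) → head≡ ; (there g∈) → headers g∈ }
        ; counts = counts′
        ; hits = λ { (here refl) ne → contradiction (fresh ≤-refl) ne
                   ; (there g∈) ne → hits g∈ ne }
        ; marked = marked ; unmarked = unmarked ; Y⊆X = Y⊆X
        ; settled = λ q∈ → contradiction q∈ ∉⊥
        ; path = start (All.tabulate λ _ q∈ → contradiction q∈ ∉⊥)
        ; size = size ; queued = queued ; in-queue = in-queue }
      ; word = word ; ssize = ssize ; sqh = sqh ; pos>0 = m<n⇒m<1+n (m<n⇒m<1+n pos>0)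
      ; below = m<n⇒m<1+n (n<1+n pos) ∷ All.map later below
      ; earlier = All.map later earlier
      ; fresh = λ pos≤ → fresh (≤-trans (m≤n⇒m≤1+n (n≤1+n pos)) pos≤)
      ; pending = record
        { linked = linked ; lists = lists
        ; owned = λ o∈ → let (A , q , g∈ , a∈) = owned o∈ in A , q , there g∈ , a∈
        ; covered = λ { (here refl) a∈ → inj₁ (refl , Equivalence.from (proj₂ ls _) a∈)
                      ; (there g∈) a∈ → inj₂ (old (covered g∈ a∈)) } }
      ; split = split
      ; budget = ≤-trans (+-monoʳ-≤ (length L) (<⇒≤ m<)) budget
      }
    where
    open Parsing P
    open Core core
    open Pending pending
    pos : ℕ
    pos = reg s rpos
    m< : suc (length xs) + work R′ < work ((A , q) ∷ R′)
    m< = ≤-reflexive (cong (λ a → 2 + a + work R′) (length-Lists ls))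
    head≡ : arr s input pos ≡ toℕ q
    head≡ = trans (word pos) (sfx 0)
    later : ∀ {i} → i < pos → i < 2 + pos
    later i< = m<n⇒m<1+n (m<n⇒m<1+n i<)
    old : ∀ {X : Set} → Empty.⊥ ⊎ X → X
    old (inj₂ x) = x
    counts′ : ∀ q′ → update (arr s cnt) (arr s input pos) (suc (arr s cnt (arr s input pos))) (toℕ q′)
                     ≡ unhit (arr s hit) q′ ((pos , A , q) ∷ G)
    counts′ q′ with q′ Fin.≟ q | arr s hit pos in eq
    ... | yes refl | zero  = trans (update-same (arr s cnt) (arr s input pos) (sym head≡))
                                   (cong suc (trans (cong (arr s cnt) head≡) (counts q)))
    ... | yes refl | suc _ = contradiction (trans (sym eq) (fresh ≤-refl)) λ ()
    ... | no q′≢q  | _     = trans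
      (update-other (arr s cnt) (arr s input pos) λ e → q′≢q (Fin.toℕ-injective (trans e head≡)))
      (counts q′)

  strikeMember-correct : ∀ {G L R′ A q a xs m} s → (reg s rj , A , q) ∈ₗ G → a ∈ A → a ≡ q →
    Parsing w R k G L R′ (λ j b → j ≡ reg s rj × b ∈ₗ a ∷ xs) (suc m) s →
    Parsing w R k G L R′ (λ j b → j ≡ reg s rj × b ∈ₗ xs) m (exec strike s)
  strikeMember-correct {G} {L} {a = a} {xs} {m} s g∈ a∈A refl P = record
    -- With nothing marked, `Y′ ⊆ ⊥`: the strike cannot have queued anything.
    { core = subst (λ Y → Core ⊥ Y G (view (exec strike s)))
                   (⊆-antisym (Core.Y⊆X S.core) (⊆-min S.Y′)) S.core
    ; word = λ i → trans (cong-app (keeps-arr input strike s) i) (word i)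
    ; ssize = ssize′
    ; sqh = trans (keeps-reg rqh strike s) sqh
    ; pos>0 = subst (0 <_) (sym pos≡) pos>0
    ; below = subst (λ p → All (λ g → proj₁ g < p) G) (sym pos≡) below
    ; earlier = subst (λ p → All (λ o → proj₁ o < p) L) (sym pos≡) earlier
    ; fresh = λ {i} pos≤ → let pos≤i = subst (_≤ i) pos≡ pos≤ in
        trans (S.others λ { refl → <⇒≱ (All.lookup below g∈) pos≤i }) (fresh pos≤i)
    ; pending = record
      { linked = subst₂ (λ f g → Linked f g L) (sym (keeps-arr next strike s))
                                                (sym (keeps-arr owner strike s)) linked
      ; lists = λ b → trans (cong-app (keeps-arr hd strike s) (toℕ b)) (lists b)
      ; owned = owned
      ; covered = λ g′∈ b∈ → still (covered g′∈ b∈)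
      }
    ; split = split
    ; budget = ≤-trans (+-monoʳ-≤ (length L) (n≤1+n m)) budget
    }
    where
    open Parsing P
    open Pending pending
    module S = Struck (strike-correct s core (λ q∈ → contradiction q∈ ∉⊥) g∈ a∈A
                        (q⊆p∪q ⊥ ⁅ a ⁆ (x∈⁅x⁆ a)))
    pos≡ : reg (exec strike s) rpos ≡ reg s rpos
    pos≡ = keeps-reg rpos strike s
    ssize′ : reg (exec strike s) rsize ≡ k
    ssize′ = trans (keeps-reg rsize strike s) ssize
    still : ∀ {j b} {X : Set} →
      (j ≡ reg s rj × b ∈ₗ a ∷ xs) ⊎ arr s hit j ≢ 0 ⊎ X →
      (j ≡ reg s rj × b ∈ₗ xs) ⊎ arr (exec strike s) hit j ≢ 0 ⊎ X
    still (inj₁ (refl , here _))   = inj₂ (inj₁ S.struck)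
    still (inj₁ (j≡ , there b∈))   = inj₁ (j≡ , b∈)
    still (inj₂ (inj₁ ne))         = inj₂ (inj₁ (S.hit-mono ne))
    still (inj₂ (inj₂ x))          = inj₂ (inj₂ x)

  -- The new cell lies above all cells of `L`, so writing `next[p]` and `owner[p]` disturbs none of
  -- them.
  linkMember-correct : ∀ {G L R′ A q a xs m} s → (reg s rj , A , q) ∈ₗ G → a ∈ A → a ≢ q →
    reg s ra ≡ toℕ a → 0 < reg s rp → reg s rp < reg s rpos →
    All (λ o → proj₁ o < reg s rp) L →
    Parsing w R k G L R′ (λ j b → j ≡ reg s rj × b ∈ₗ a ∷ xs) (suc m) s →
    Parsing w R k G ((reg s rp , a , reg s rj) ∷ L) R′
            (λ j b → j ≡ reg s rj × b ∈ₗ xs) m (exec linkMember s)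
  linkMember-correct {G} {L} {a = a} {xs} {m} s g∈ a∈A a≢q ra≡ 0<p p<pos lower P = record
    { core = core ; word = word ; ssize = ssize ; sqh = sqh ; pos>0 = pos>0 ; below = below
    ; earlier = p<pos ∷ earlier
    ; fresh = fresh
    ; pending = record
      { linked = link 0<p
          (trans (update-same (arr s next) p refl) (trans (cong (arr s hd) ra≡) (lists a)))
          (update-same (arr s owner) p refl)
          (Linked-cong (All.map (λ o< → update-other (arr s next) p (<⇒≢ o<)) lower)
                       (All.map (λ o< → update-other (arr s owner) p (<⇒≢ o<)) lower) linked)
      ; lists = lists′
      ; owned = λ { (here refl) → _ , _ , g∈ , a∈A ; (there o∈) → owned o∈ }
      ; covered = λ g′∈ b∈ → covered′ g′∈ (covered g′∈ b∈)
      }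
    ; split = split
    ; budget = ≤-trans (≤-reflexive (sym (+-suc (length L) m))) budget
    }
    where
    open Parsing P
    open Pending pending
    p : ℕ
    p = reg s rp
    lists′ : ∀ b → update (arr s hd) (reg s ra) p (toℕ b) ≡ first b ((p , a , reg s rj) ∷ L)
    lists′ b with b Fin.≟ a
    ... | yes refl = update-same (arr s hd) (reg s ra) (sym ra≡)
    ... | no  b≢a  = trans
      (update-other (arr s hd) (reg s ra) λ eq → b≢a (Fin.toℕ-injective (trans eq ra≡)))
      (lists b)
    covered′ : ∀ {j B q′ b} → (j , B , q′) ∈ₗ G →
      (j ≡ reg s rj × b ∈ₗ a ∷ xs) ⊎ arr s hit j ≢ 0 ⊎ (b ≢ q′ × ∃[ p′ ] (p′ , b , j) ∈ₗ L) →
      (j ≡ reg s rj × b ∈ₗ xs) ⊎ arr s hit j ≢ 0 ⊎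
      (b ≢ q′ × ∃[ p′ ] (p′ , b , j) ∈ₗ (p , a , reg s rj) ∷ L)
    -- By distinctness the rule at this header is the open one, so its head is `q` and `a≢q`
    -- applies.
    covered′ g′∈ (inj₁ (refl , here refl))
      with refl ← placed-unique (Core.distinct core) g′∈ g∈ refl =
      inj₂ (inj₂ (a≢q , p , here refl))
    covered′ g′∈ (inj₁ (j≡ , there b∈))            = inj₁ (j≡ , b∈)
    covered′ g′∈ (inj₂ (inj₁ ne))                  = inj₂ (inj₁ ne)
    covered′ g′∈ (inj₂ (inj₂ (b≢q , p′ , o∈)))     = inj₂ (inj₂ (b≢q , p′ , there o∈))

  nextMember-correct : ∀ {G L R′ v A q a xs} s →
    reg s rrem ≡ suc (length xs) → reg s rrules ≡ suc (length R′) →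
    reg s rhead ≡ toℕ q → (reg s rj , A , q) ∈ₗ G → All (_∈ A) (a ∷ xs) →
    EncodesRules R′ v → Suffix w (reg s rpos) (map toℕ (a ∷ xs) ++ v) →
    Parsing w R k G L R′ (λ j b → j ≡ reg s rj × b ∈ₗ a ∷ xs)
            (suc (suc (length xs)) + work R′) s →
    ParseInv (suc (length xs) + work R′) (exec nextMember s)
  nextMember-correct {G} {L} {R′} {v} {A} {q} {a} {xs} s rem≡ nr≡ head≡ g∈ (a∈A ∷ xs⊆A) enc sfx P =
    branch (equal ra rhead) strike linkMember s₁ (ParseInv (suc (length xs) + work R′))
      (λ eq → struck (Fin.toℕ-injective
        (trans (sym ra≡) (trans (equal-true {ra} {rhead} {s₁} eq) head≡))))
      (λ ne → linked λ a≡q → equal-false {ra} {rhead} {s₁} ne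
        (trans ra≡ (trans (cong toℕ a≡q) (sym head≡))))
    where
    open Parsing P
    s₁ : State
    s₁ = exec (load ra input rpos ⨾ copy rp rpos ⨾ inc rpos) s
    ra≡ : arr s input (reg s rpos) ≡ toℕ a
    ra≡ = trans (word (reg s rpos)) (sfx 0)
    P₁ : Parsing w R k G L R′ (λ j b → j ≡ reg s rj × b ∈ₗ a ∷ xs)
                 (suc (suc (length xs)) + work R′) s₁
    P₁ = record
      { core = core ; word = word ; ssize = ssize ; sqh = sqh ; pos>0 = m<n⇒m<1+n pos>0
      ; below = All.map m<n⇒m<1+n below ; earlier = All.map m<n⇒m<1+n earlier
      ; fresh = λ pos< → fresh (<⇒≤ pos<)
      ; pending = pending ; split = split ; budget = budget }
    struck : a ≡ q → ParseInv (suc (length xs) + work R′) (exec strike s₁)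
    struck a≡q = busy
      (trans (keeps-reg rrem strike s₁) rem≡) (trans (keeps-reg rrules strike s₁) nr≡)
      (trans (keeps-reg rhead strike s₁) head≡)
      (subst (λ j → (j , A , q) ∈ₗ G) (sym j≡) g∈) xs⊆A enc
      (subst (λ p → Suffix w p (map toℕ xs ++ v)) (sym (keeps-reg rpos strike s₁))
             (Suffix-tail {w} sfx))
      (subst (λ i → Parsing w R k G L R′ (λ j b → j ≡ i × b ∈ₗ xs)
                            (suc (length xs) + work R′) (exec strike s₁)) (sym j≡)
             (strikeMember-correct s₁ g∈ a∈A a≡q P₁))
      where
      j≡ : reg (exec strike s₁) rj ≡ reg s rj
      j≡ = keeps-reg rj strike s₁
    linked : a ≢ q → ParseInv (suc (length xs) + work R′) (exec linkMember s₁)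
    linked a≢q = busy rem≡ nr≡ head≡ g∈ xs⊆A enc (Suffix-tail {w} sfx)
      (linkMember-correct s₁ g∈ a∈A a≢q ra≡ pos>0 ≤-refl earlier P₁)

  parseStep-correct : ∀ {m s} → ParseInv m s → test (less rzero rrules) s ≡ true →
                      Progress m (exec parseStep s)
  parseStep-correct {m} {s} (idle rem≡ nr≡ enc sfx P) t =
    branch (equal rrem rzero) openRule resumeRule s (Progress m) (λ _ → opened enc nr≡ sfx P)
      (λ ne → contradiction (trans rem≡ (sym zero-const)) (equal-false {rrem} {rzero} {s} ne))
    where
    open Core (Parsing.core P)
    opened : ∀ {G L R′ v} → EncodesRules R′ v → reg s rrules ≡ length R′ →
             Suffix w (reg s rpos) v → Parsing w R k G L R′ Nothing (work R′) s →
             Progress (work R′) (exec openRule s)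
    opened [] nr≡ sfx P = contradiction
      (subst (reg s rzero <_) nr≡ (less-true {rzero} {rrules} {s} t)) n≮0
    opened (ls ∷ enc) nr≡ sfx P = openRule-correct s nr≡ ls enc sfx P
  parseStep-correct {m} {s} (busy {G} {L} {R′} {v} {xs = xs} rem≡ nr≡ head≡ g∈ xs⊆A enc sfx P) t =
    branch (equal rrem rzero) openRule resumeRule s (Progress m)
      (λ eq → contradiction
        (trans (sym rem≡) (trans (equal-true {rrem} {rzero} {s} eq) zero-const)) λ ())
      (λ _ → branch (equal rrem rzero) (dec rrules) nextMember s₁ (Progress m)
        (λ eq → closed xs (trans (sym rem₁≡)
                 (trans (equal-true {rrem} {rzero} {s₁} eq) zero-const)) rem₁≡ sfx P)
        (λ ne → member xs xs⊆A (λ e → equal-false {rrem} {rzero} {s₁} ne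
                 (trans (trans rem₁≡ e) (sym zero-const))) rem₁≡ sfx P))
    where
    open Core (Parsing.core P)
    s₁ : State
    s₁ = exec (dec rrem) s
    rem₁≡ : reg s₁ rrem ≡ length xs
    rem₁≡ = cong pred rem≡
    Todo : List (Fin n) → ℕ → Fin n → Set
    Todo xs j a = j ≡ reg s rj × a ∈ₗ xs
    keep : ∀ {Todo m} → Parsing w R k G L R′ Todo m s → Parsing w R k G L R′ Todo m s₁
    keep P = record { Parsing P }
    closed : ∀ xs → length xs ≡ 0 → reg s₁ rrem ≡ length xs →
             Suffix w (reg s rpos) (map toℕ xs ++ v) →
             Parsing w R k G L R′ (Todo xs) (suc (length xs) + work R′) s →
             Progress (suc (length xs) + work R′) (exec (dec rrules) s₁)
    closed [] _ rem₁≡ sfx P = work R′ , n<1+n _ , idle rem₁≡ (cong pred nr≡) enc sfx record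
      { Parsing P
      ; pending = record { Pending pending ; covered = λ g∈ a∈ → still (covered g∈ a∈) }
      ; budget = ≤-trans (+-monoʳ-≤ (length L) (n≤1+n (work R′))) budget }
      where
      open Parsing P
      open Pending pending
      still : ∀ {j a} {X : Set} → Todo [] j a ⊎ X → Empty.⊥ ⊎ X
      still (inj₂ x) = inj₂ x
    member : ∀ xs → All (_∈ _) xs → length xs ≢ 0 → reg s₁ rrem ≡ length xs →
             Suffix w (reg s rpos) (map toℕ xs ++ v) →
             Parsing w R k G L R′ (Todo xs) (suc (length xs) + work R′) s →
             Progress (suc (length xs) + work R′) (exec nextMember s₁)
    member []       _    ne _ _ _ = contradiction refl ne
    member (a ∷ xs) xs⊆A ne rem₁≡ sfx P = suc (length xs) + work R′ , n<1+n _ ,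
      nextMember-correct s₁ rem₁≡ nr≡ head≡ g∈ xs⊆A enc sfx (keep P)

-- Marking X and propagating

Pending-cong : ∀ {n} {Todo : ℕ → Fin n → Set} {G L h n′ o t h₁ n₁ o₁ t₁} →
               h₁ ≡ h → n₁ ≡ n′ → o₁ ≡ o → t₁ ≡ t →
               Pending Todo G L h n′ o t → Pending Todo G L h₁ n₁ o₁ t₁
Pending-cong refl refl refl refl p = p

-- After reading, an element has counter 0 exactly if it belongs to every rule of which it is the
-- head. Such elements can be queued as soon as they are marked, and they seed the queue.
fetchMember markStep : Program
fetchMember = dec rleft ⨾ load rq input rpos ⨾ inc rpos ⨾ store inX rq rone
markStep    = fetchMember ⨾ tryPush

module _ {n : ℕ} (w : List ℕ) (X : Subset n) (k : ℕ) (G : List (Placed n))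
         (L : List (Occurrence n)) (v : List ℕ) where

  record Marking (xs : List (Fin n)) (X′ Y : Subset n) (s : State) : Set where
    field
      core    : Core X′ Y G (view s)
      closed  : Closed X′ Y G (arr s hit)
      pending : PendingIn Nothing G L s
      word    : ∀ i → arr s input i ≡ at w i
      ssize   : reg s rsize ≡ k
      sqh     : reg s rqh ≡ 0
      left    : reg s rleft ≡ length xs
      suffix  : Suffix w (reg s rpos) (map toℕ xs ++ v)
      unique  : Unique xs
      unseen  : ∀ {x} → x ∈ₗ xs → x ∉ X′
      X′⊆X    : X′ ⊆ X
      xs⊆X    : ∀ {x} → x ∈ₗ xs → x ∈ X
      cover   : ∀ {x} → x ∈ X → x ∈ X′ ⊎ x ∈ₗ xs

  data MarkInv : ℕ → State → Set where
    marking : ∀ {xs X′ Y s} → Marking xs X′ Y s → MarkInv (length xs) s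

  markStep-correct : ∀ {m s} → MarkInv m s → test (less rzero rleft) s ≡ true →
                     ∃[ m′ ] m′ < m × MarkInv m′ (exec markStep s)
  markStep-correct {s = s} (marking {[]} I) t = contradiction
    (subst (reg s rzero <_) (Marking.left I) (less-true {rzero} {rleft} {s} t)) n≮0
  markStep-correct {s = s} (marking {x ∷ xs} {X′} {Y} I) t = length xs , ≤-refl , marking record
    { core = core′ ; closed = closed′
    ; pending = Pending-cong (keeps-arr hd tryPush s₁) (keeps-arr next tryPush s₁)
                  (keeps-arr owner tryPush s₁) (keeps-arr hit tryPush s₁) pending
    ; word = λ i → trans (cong-app (keeps-arr input tryPush s₁) i) (word i)
    ; ssize = trans (keeps-reg rsize tryPush s₁) ssize
    ; sqh = trans (keeps-reg rqh tryPush s₁) sqh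
    ; left = trans (keeps-reg rleft tryPush s₁) (cong pred left)
    ; suffix = subst (λ p → Suffix w p (map toℕ xs ++ v)) (sym (keeps-reg rpos tryPush s₁))
                     (Suffix-tail {w} suffix)
    ; unique = tail unique
    ; unseen = unseen′
    ; X′⊆X = λ y∈ → new-or-old (_∈ X) X′⊆X (xs⊆X (here refl)) y∈
    ; xs⊆X = λ y∈ → xs⊆X (there y∈)
    ; cover = λ y∈ → cover′ (cover y∈)
    }
    where
    open Marking I
    open Core core
    s₁ : State
    s₁ = exec fetchMember s
    X″ : Subset n
    X″ = X′ ∪ ⁅ x ⁆
    x∈X″ : x ∈ X″
    x∈X″ = q⊆p∪q X′ ⁅ x ⁆ (x∈⁅x⁆ x)
    X′⊆X″ : X′ ⊆ X″
    X′⊆X″ = p⊆p∪q ⁅ x ⁆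
    new-or-old : (P : Fin n → Set) → (∀ {y} → y ∈ X′ → P y) → P x → ∀ {y} → y ∈ X″ → P y
    new-or-old P old new y∈ with x∈p∪q⁻ X′ ⁅ x ⁆ y∈
    ... | inj₁ y∈X′ = old y∈X′
    ... | inj₂ y∈x  = subst P (sym (x∈⁅y⁆⇒x≡y x y∈x)) new
    -- `Y` contains only marked elements, and `x` is marked for the first time because `X` is listed
    -- without repetition.
    x∉Y : x ∉ Y
    x∉Y x∈Y = unseen (here refl) (Y⊆X x∈Y)
    x≡ : arr s input (reg s rpos) ≡ toℕ x
    x≡ = trans (word (reg s rpos)) (suffix 0)
    elsewhere : ∀ {y} → y ≢ x → arr s₁ inX (toℕ y) ≡ arr s inX (toℕ y)
    elsewhere y≢x = update-other (arr s inX) (arr s input (reg s rpos))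
      λ eq → y≢x (Fin.toℕ-injective (trans eq x≡))
    marked′ : ∀ {y} → y ∈ X″ → arr s₁ inX (toℕ y) ≡ 1
    marked′ {y} y∈ with y Fin.≟ x
    ... | yes refl = trans (update-same (arr s inX) (arr s input (reg s rpos)) (sym x≡)) one-const
    ... | no  y≢x  = trans (elsewhere y≢x)
      (new-or-old (λ y → y ≢ x → arr s inX (toℕ y) ≡ 1) (λ y∈X′ _ → marked y∈X′)
                  (contradiction refl) y∈ y≢x)
    p : Pushed X″ Y G (view s₁) (view (exec tryPush s₁))
    p = tryPush-correct s₁ record
          { zero-const = zero-const ; one-const = one-const ; distinct = distinct
          ; headers = headers ; counts = counts ; hits = hits
          ; marked = marked′
          ; unmarked = λ y∉ → trans (elsewhere λ { refl → y∉ x∈X″ })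
                                    (unmarked λ y∈ → y∉ (X′⊆X″ y∈))
          ; Y⊆X = λ y∈ → X′⊆X″ (Y⊆X y∈)
          ; settled = settled ; path = path ; size = size
          ; queued = queued ; in-queue = in-queue }
        x≡ x∉Y
        (λ y∈ y≢x eq → new-or-old (λ y → y ≢ x → unhit (arr s hit) y G ≡ 0 → y ∈ Y)
          (λ y∈X′ _ → closed y∈X′) (contradiction refl) y∈ y≢x eq)
    open Pushed p using () renaming (core to core′; closed to closed′)
    unseen′ : ∀ {y} → y ∈ₗ xs → y ∉ X″
    unseen′ y∈xs y∈ = new-or-old (λ y → ¬ y ∈ₗ xs)
      (λ y∈X′ y∈xs → unseen (there y∈xs) y∈X′)
      (λ x∈xs → All.lookup (head unique) x∈xs refl) y∈ y∈xs
    cover′ : ∀ {y} → y ∈ X′ ⊎ y ∈ₗ x ∷ xs → y ∈ X″ ⊎ y ∈ₗ xs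
    cover′ (inj₁ y∈X′)        = inj₁ (X′⊆X″ y∈X′)
    cover′ (inj₂ (here refl)) = inj₁ x∈X″
    cover′ (inj₂ (there y∈))  = inj₂ y∈

-- One iteration handles one cell of the front element, or drops that element once its list is
-- empty, so `hd` is reloaded every time.
unlinkFirst follow propagateStep answer : Program
unlinkFirst   = load rnext next rp ⨾ store hd ra rnext ⨾ load rj owner rp
follow        = unlinkFirst ⨾ strike
propagateStep = load ra queue rqh ⨾ load rp hd ra ⨾ ifThenElse (equal rp rzero) (inc rqh) follow
answer        = ifThenElse (equal rqt rsize) (const 0 1) (const 0 0)

module _ {n : ℕ} (X : Subset n) (k : ℕ) (G : List (Placed n)) where

  record Propagating (L : List (Occurrence n)) (Y : Subset n) (s : State) : Set where
    field
      core    : Core X Y G (view s)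
      closed  : Closed X Y G (arr s hit)
      pending : PendingIn Nothing G L s
      ssize   : reg s rsize ≡ k
      retired : ∀ {i p a j} → i < reg s rqh → (p , a , j) ∈ₗ L → arr s queue i ≢ toℕ a

  -- Every iteration either consumes a cell of `L` or advances `rqh`; pushes leave both terms alone.
  data PropagateInv : ℕ → State → Set where
    propagating : ∀ {L Y s} → Propagating L Y s → PropagateInv (length L + (n ∸ reg s rqh)) s

  propagateStep-correct : ∀ {m s} → PropagateInv m s → test (less rqh rqt) s ≡ true →
                          ∃[ m′ ] m′ < m × PropagateInv m′ (exec propagateStep s)
  propagateStep-correct {m} {s} (propagating {L} {Y} I) t =
    branch (equal rp rzero) (inc rqh) follow s₁ (λ s′ → ∃[ m′ ] m′ < m × PropagateInv m′ s′)
      (λ eq → retire (trans (sym p≡) (trans (equal-true {rp} {rzero} {s₁} eq) zero-const)))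
      (λ ne → advance λ e → equal-false {rp} {rzero} {s₁} ne
                              (trans p≡ (trans e (sym zero-const))))
    where
    open Propagating I
    open Core core
    open Pending pending
    s₁ s₂ : State
    s₁ = exec (load ra queue rqh ⨾ load rp hd ra) s
    s₂ = exec unlinkFirst s₁
    qh a p : ℕ
    qh = reg s rqh
    a = arr s queue qh
    p = arr s hd a
    qh<qt : qh < reg s rqt
    qh<qt = less-true {rqh} {rqt} {s} t
    front : ∃[ y ] y ∈ Y × a ≡ toℕ y
    front = in-queue qh<qt
    y : Fin n
    y = proj₁ front
    y∈Y : y ∈ Y
    y∈Y = proj₁ (proj₂ front)
    a≡ : a ≡ toℕ y
    a≡ = proj₂ (proj₂ front)
    p≡ : p ≡ first y L
    p≡ = trans (cong (arr s hd) a≡) (lists y)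
    -- Truncated subtraction decreases strictly only below `n`; the queue holds `∣ Y ∣ ≤ n` entries.
    qh<n : qh < n
    qh<n = ≤-trans qh<qt (subst (_≤ n) (sym size) (∣p∣≤n Y))

    retire : first y L ≡ 0 → ∃[ m′ ] m′ < m × PropagateInv m′ (exec (inc rqh) s₁)
    retire none = length L + (n ∸ suc qh) ,
      +-monoʳ-< (length L) (∸-monoʳ-< (n<1+n qh) qh<n) ,
      propagating record
        { core = core ; closed = closed ; pending = pending ; ssize = ssize
        ; retired = retired′ }
      where
      retired′ : ∀ {i p b j} → i < suc qh → (p , b , j) ∈ₗ L → arr s queue i ≢ toℕ b
      retired′ i≤qh o∈ eq with m<1+n⇒m<n∨m≡n i≤qh
      ... | inj₁ i<qh = retired i<qh o∈ eq
      ... | inj₂ refl with refl ← Fin.toℕ-injective (trans (sym a≡) eq) =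
        first≡0⇒∉ linked none o∈

    advance : first y L ≢ 0 → ∃[ m′ ] m′ < m × PropagateInv m′ (exec strike s₂)
    advance some = length U.rest + (n ∸ reg (exec strike s₂) rqh) ,
      ≤-reflexive (cong₂ (λ l q → l + (n ∸ q)) (sym U.length-rest) qh≡) ,
      propagating record
        { core = S.core ; closed = S.closed
        ; pending = record
          { linked = subst₂ (λ f g → Linked f g U.rest) (sym (keeps-arr next strike s₂))
                            (sym (keeps-arr owner strike s₂)) U.linked
          ; lists = λ b → trans (cong-app (keeps-arr hd strike s₂) (toℕ b)) (lists′ b)
          ; owned = λ o∈ → owned (U.rest⊆ o∈)
          ; covered = λ g∈ b∈ → covered′ (covered g∈ b∈) }
        ; ssize = trans (keeps-reg rsize strike s₂) ssize
        ; retired = λ {i} i< o∈ eq → let i<qh = subst (i <_) qh≡ i< in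
            retired i<qh (U.rest⊆ o∈) (trans (sym (S.prefix (<-trans i<qh qh<qt))) eq)
        }
      where
      module U = Unlinked (subst (λ p → Unlinked (arr s next) (arr s owner) y p L) (sym p≡)
                                 (unlink y linked some))
      module S = Struck (strike-correct s₂ core closed
                   (proj₁ (proj₂ (proj₂ (owned U.occurs)))) (proj₂ (proj₂ (proj₂ (owned U.occurs))))
                   (p⊆p∪q _ y∈Y))
      qh≡ : reg (exec strike s₂) rqh ≡ qh
      qh≡ = keeps-reg rqh strike s₂
      lists′ : ∀ b → update (arr s hd) a (arr s next p) (toℕ b) ≡ first b U.rest
      lists′ b with b Fin.≟ y
      ... | yes refl = trans (update-same (arr s hd) a (sym a≡)) U.next-first
      ... | no  b≢y  = trans
        (update-other (arr s hd) a λ eq → b≢y (Fin.toℕ-injective (trans eq a≡)))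
        (trans (lists b) (sym (U.first-rest b≢y)))
      covered′ : ∀ {j b q} →
        Empty.⊥ ⊎ arr s hit j ≢ 0 ⊎ (b ≢ q × ∃[ p ] (p , b , j) ∈ₗ L) →
        Empty.⊥ ⊎ arr (exec strike s₂) hit j ≢ 0 ⊎ (b ≢ q × ∃[ p ] (p , b , j) ∈ₗ U.rest)
      covered′ (inj₂ (inj₁ ne)) = inj₂ (inj₁ (S.hit-mono ne))
      -- If the cell in question is the one just removed, its rule has been struck and is covered as
      -- hit.
      covered′ (inj₂ (inj₂ (b≢q , p , o∈))) with U.split o∈
      ... | inj₁ refl = inj₂ (inj₁ S.struck)
      ... | inj₂ o∈′  = inj₂ (inj₂ (b≢q , p , o∈′))

  module _ {L Y s} (I : Propagating L Y s) (done : reg s rqt ≤ reg s rqh) where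
    open Propagating I
    open Core core
    open Pending pending

    -- Maximality: the first element outside Y on a tight path would be the head
    -- of an unhit rule, none of whose members lies in Y.
    reachable⊆Y : ∀ {Z} → TightPath (𝒦 (map proj₂ G)) ⊥ Z → Z ⊆ X → Z ⊆ Y
    reachable⊆Y (start _) _ z∈ = contradiction z∈ ∉⊥
    reachable⊆Y (extend {W} {Z} path kZ W⊆Z one) Z⊆X {z} z∈Z with z ∈? W | z ∈? Y
    ... | yes z∈W | _       = reachable⊆Y path (λ y∈ → Z⊆X (W⊆Z y∈)) z∈W
    ... | no  _   | yes z∈Y = z∈Y
    ... | no  z∉W | no  z∉Y = contradiction
      (reachable⊆Y path (λ y∈ → Z⊆X (W⊆Z y∈)) a∈W) a∉Y
      where
      blocking : ∃[ j ] ∃[ A ] (j , A , z) ∈ₗ G × arr s hit j ≡ 0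
      blocking = unhit≢0⇒∃ (arr s hit) z G λ eq → z∉Y (closed (Z⊆X z∈Z) eq)
      j : ℕ
      j = proj₁ blocking
      A : Subset n
      A = proj₁ (proj₂ blocking)
      g∈ : (j , A , z) ∈ₗ G
      g∈ = proj₁ (proj₂ (proj₂ blocking))
      met : Nonempty (Z ∩ A)
      met = All.lookup kZ (∈-map⁺ proj₂ g∈) z∈Z
      a : Fin n
      a = proj₁ met
      a∈ : a ∈ Z × a ∈ A
      a∈ = x∈p∩q⁻ Z A (proj₂ met)
      -- The blocking rule is unhit and nothing is unread, so `covered` leaves only the list cell.
      waiting : a ≢ z × ∃[ p ] (p , a , j) ∈ₗ L
      waiting with covered g∈ (proj₂ a∈)
      ... | inj₂ (inj₁ ne) = contradiction (proj₂ (proj₂ (proj₂ blocking))) ne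
      ... | inj₂ (inj₂ x)  = x
      -- `z` is the only element of `Z` outside `W`, and `a` differs from `z`.
      a∈W : a ∈ W
      a∈W with a ∈? W
      ... | yes a∈W = a∈W
      ... | no  a∉W = contradiction
        (∣p∣≡1⇒unique one (x∈p∧x∉q⇒x∈p─q (proj₁ a∈) a∉W) (x∈p∧x∉q⇒x∈p─q z∈Z z∉W))
        (proj₁ waiting)
      -- The loop has ended, so every queued element is retired and owns no cell, whereas `a` still
      -- has one.
      a∉Y : a ∉ Y
      a∉Y a∈Y = let (i , i<qt , eq) = queued a∈Y in
        retired (≤-trans i<qt done) (proj₂ (proj₂ waiting)) eq

    -- `G` holds the rules in reverse order of reading; `𝒦` depends only on membership in the list,
    -- so tight paths carry over in both directions.
    answer-correct : k ≡ ∣ X ∣ → Answers (exec answer s) (𝒜 (map proj₂ G ʳ++ []) X)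
    answer-correct k≡ =
      branch (equal rqt rsize) (const 0 1) (const 0 0) s
        (λ s′ → Answers s′ (𝒜 (map proj₂ G ʳ++ []) X))
        (λ eq → true , ofʸ (accept (equal-true {rqt} {rsize} {s} eq)) , refl)
        (λ ne → false , ofⁿ (reject (equal-false {rqt} {rsize} {s} ne)) , refl)
      where
      to-reverse : ∀ {K} → 𝒦 (map proj₂ G) K → 𝒦 (map proj₂ G ʳ++ []) K
      to-reverse k = All.tabulate λ r∈ → All.lookup k (Any.reverse⁻ r∈)
      from-reverse : ∀ {K} → 𝒦 (map proj₂ G ʳ++ []) K → 𝒦 (map proj₂ G) K
      from-reverse k = All.tabulate λ r∈ → All.lookup k (Any.reverse⁺ r∈)
      accept : reg s rqt ≡ reg s rsize → 𝒜 (map proj₂ G ʳ++ []) X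
      accept eq = path-end path′ , path′
        where
        Y≡X : Y ≡ X
        Y≡X = p⊆q∧∣p∣≡∣q∣⇒p≡q Y⊆X (trans (sym size) (trans eq (trans ssize k≡)))
        path′ : TightPath (𝒦 (map proj₂ G ʳ++ [])) ⊥ X
        path′ = TightPath-map to-reverse (subst (TightPath _ ⊥) Y≡X path)
      reject : reg s rqt ≢ reg s rsize → ¬ 𝒜 (map proj₂ G ʳ++ []) X
      reject ne (_ , pathX) = ne (trans size (trans (cong ∣_∣ Y≡X) (sym (trans ssize k≡))))
        where
        Y≡X : Y ≡ X
        Y≡X = ⊆-antisym Y⊆X (reachable⊆Y (TightPath-map from-reverse pathX) λ x∈ → x∈)

-- The algorithm

-- In the input word `X` precedes the rules but is marked after them: it is skipped first, and
-- `rewind` returns to address 2, just behind `n` and `∣ X ∣`.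
setup skipStep findRules rewind algorithm : Program
setup     = const rone 1 ⨾ const rpos 1 ⨾ load rsize input rpos ⨾ inc rpos ⨾ copy rleft rsize
skipStep  = dec rleft ⨾ inc rpos
findRules = load rrules input rpos ⨾ inc rpos
rewind    = const rpos 2 ⨾ copy rleft rsize
algorithm =
  setup ⨾ while (less rzero rleft) skipStep ⨾
  findRules ⨾ while (less rzero rrules) parseStep ⨾
  rewind ⨾ while (less rzero rleft) markStep ⨾
  while (less rqh rqt) propagateStep ⨾
  answer

-- Per rule, `2 + ∣ A ∣` is at most twice the contribution `∣ A ∣ + 1` to `ℓ`.
work≤2ℓ : ∀ {n} (R : List (Rule n)) → work R ≤ 2 * ℓ R
work≤2ℓ []            = z≤n
work≤2ℓ ((A , _) ∷ R) =
  ≤-trans (+-monoʳ-≤ (2 + ∣ A ∣) (work≤2ℓ R))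
    (≤-trans (m≤n+m (2 + ∣ A ∣ + 2 * ℓ R) ∣ A ∣) (≤-reflexive (regroup ∣ A ∣ (ℓ R))))
  where
  regroup : ∀ a l → a + (2 + a + 2 * l) ≡ 2 * (a + 1 + l)
  regroup = solve-∀

-- No iteration count exceeds 3 ℓ, the last loop making at most work R + n steps.
loopTime : Program → ℕ → ℕ
loopTime P l = 1 + 3 * l * suc (cost P)

time : ℕ → ℕ
time l =
  cost setup + (loopTime skipStep l + (cost findRules + (loopTime parseStep l +
  (cost rewind + (loopTime markStep l + (loopTime propagateStep l + cost answer))))))

-- Linearity of the time bound.

Linear : (ℕ → ℕ) → Set
Linear f = f ∈O λ l → l

const-linear : ∀ k → Linear λ _ → k
-- The threshold 1 excludes `m = 0`, where `k * m` vanishes.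
const-linear k = k , 1 , λ m 1≤m → ≤-trans (≤-reflexive (sym (*-identityʳ k))) (*-monoʳ-≤ k 1≤m)

+-linear : ∀ {f g} → Linear f → Linear g → Linear λ l → f l + g l
+-linear (c , N , f≤) (d , M , g≤) = c + d , N + M , λ m N+M≤m →
  ≤-trans (+-mono-≤ (f≤ m (≤-trans (m≤m+n N M) N+M≤m)) (g≤ m (≤-trans (m≤n+m M N) N+M≤m)))
          (≤-reflexive (sym (*-distribʳ-+ m c d)))

loopTime-linear : ∀ P → Linear (loopTime P)
loopTime-linear P = +-linear (const-linear 1)
  (3 * suc (cost P) , 0 , λ m _ → ≤-reflexive (regroup m (suc (cost P))))
  where
  regroup : ∀ m c → 3 * m * c ≡ 3 * c * m
  regroup = solve-∀

time-linear : Linear time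
time-linear =
  +-linear (const-linear (cost setup)) (+-linear (loopTime-linear skipStep)
  (+-linear (const-linear (cost findRules)) (+-linear (loopTime-linear parseStep)
  (+-linear (const-linear (cost rewind)) (+-linear (loopTime-linear markStep)
  (+-linear (loopTime-linear propagateStep) (const-linear (cost answer))))))))

-- The run of the algorithm on a fixed instance.

module Run {n : ℕ} {R : List (Rule n)} {X : Subset n} {xs : List (Fin n)} {v : List ℕ}
           (n≤ℓ : n ≤ ℓ R) (ls : Lists xs X) (enc : EncodesRules R v) where

  rest w : List ℕ
  rest = length R ∷ v
  w    = n ∷ block xs ++ rest

  record Skipping (ys : List (Fin n)) (s : State) : Set where
    field
      arrays : arr s ≡ arr (initial w)
      szero  : reg s rzero ≡ 0
      sone   : reg s rone ≡ 1
      ssize  : reg s rsize ≡ length xs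
      srem   : reg s rrem ≡ 0
      sqh    : reg s rqh ≡ 0
      sqt    : reg s rqt ≡ 0
      left   : reg s rleft ≡ length ys
      suffix : Suffix w (reg s rpos) (map toℕ ys ++ rest)

  data SkipInv : ℕ → State → Set where
    skipping : ∀ {ys s} → Skipping ys s → SkipInv (length ys) s

  Parsed : State → Set
  Parsed s = ∃[ G ] ∃[ L ] Parsing w R (length xs) G L [] Nothing 0 s

  afterSetup : ∀ i → at w (i + 2) ≡ at (map toℕ xs ++ rest) i
  afterSetup = Suffix-tail {w} (Suffix-tail {w} λ i → cong (at w) (+-identityʳ i))

  setup-halts : Halts setup (initial w) (cost setup) (Skipping xs)
  setup-halts = straight setup (initial w) (Skipping xs) record
    { arrays = refl ; szero = refl ; sone = refl ; ssize = refl ; srem = refl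
    ; sqh = refl ; sqt = refl ; left = refl ; suffix = afterSetup }

  -- The assumption `n ≤ ℓ R` enters here, for the scans of `X`, and again in the bound on queue
  -- entries during propagation.
  ∣xs∣≤3ℓ : length xs ≤ 3 * ℓ R
  ∣xs∣≤3ℓ = ≤-trans (≤-reflexive (length-Lists ls))
    (≤-trans (∣p∣≤n X) (≤-trans n≤ℓ (m≤n*m (ℓ R) 3)))

  skipStep-correct : ∀ {m s} → SkipInv m s → test (less rzero rleft) s ≡ true →
                     ∃[ m′ ] m′ < m × SkipInv m′ (exec skipStep s)
  skipStep-correct {s = s} (skipping {[]} I) t = contradiction
    (subst (reg s rzero <_) (Skipping.left I) (less-true {rzero} {rleft} {s} t)) n≮0
  skipStep-correct {s = s} (skipping {y ∷ ys} I) t = length ys , ≤-refl , skipping {ys} record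
    { Skipping I ; left = cong pred left ; suffix = Suffix-tail {w} suffix }
    where open Skipping I

  skip-halts : ∀ s → Skipping xs s →
    Halts (while (less rzero rleft) skipStep) s (loopTime skipStep (ℓ R)) (Skipping [])
  skip-halts s I =
    let (s′ , t , d , t≤ , fin , m , J) =
          loop (less rzero rleft) skipStep SkipInv skipStep-correct (3 * ℓ R) ∣xs∣≤3ℓ (skipping I)
    in s′ , t , d , t≤ , finished J fin
    where
    finished : ∀ {m s} → SkipInv m s → test (less rzero rleft) s ≡ false → Skipping [] s
    finished (skipping {[]} I) _ = I
    finished {s = s} (skipping {_ ∷ _} I) t = contradiction
      (subst₂ _≤_ (Skipping.left I) (Skipping.szero I) (less-false {rzero} {rleft} {s} t)) n≮0

  -- The zero memory already encodes the start, so no initialisation pass is needed: counters and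
  -- marks are 0, all lists and the queue are empty. Matching `arrays` with `refl` lets these facts
  -- compute.
  findRules-halts : ∀ s → Skipping [] s →
    Halts findRules s (cost findRules) (ParseInv w R (length xs) (work R))
  findRules-halts (state r a) record { arrays = refl ; szero = szero ; sone = sone ; ssize = ssize
                            ; srem = srem ; sqh = sqh ; sqt = sqt
                            ; left = left ; suffix = suffix } =
    straight findRules s (ParseInv w R (length xs) (work R))
      (idle {G = []} {L = []} srem (suffix 0) enc (Suffix-tail {w} suffix) record
        { core = record
          { zero-const = szero ; one-const = sone ; distinct = [] ; headers = λ ()
          ; counts = λ _ → refl ; hits = λ () ; marked = λ q∈ → contradiction q∈ ∉⊥
          ; unmarked = λ _ → refl ; Y⊆X = λ q∈ → q∈ ; settled = λ _ → refl
          ; path = start [] ; size = trans sqt (sym (∣⊥∣≡0 n))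
          ; queued = λ q∈ → contradiction q∈ ∉⊥
          ; in-queue = λ i< → contradiction (subst (_ <_) sqt i<) n≮0 }
        ; word = λ _ → refl ; ssize = ssize ; sqh = sqh ; pos>0 = s≤s z≤n
        ; below = [] ; earlier = [] ; fresh = λ _ → refl
        ; pending = record { linked = [] ; lists = λ _ → refl ; owned = λ () ; covered = λ () }
        ; split = refl ; budget = ≤-refl })
    where
    s : State
    s = state r (arr (initial w))

  work≤3ℓ : work R ≤ 3 * ℓ R
  work≤3ℓ = ≤-trans (work≤2ℓ R) (*-monoˡ-≤ (ℓ R) (n≤1+n 2))

  parse-halts : ∀ s → ParseInv w R (length xs) (work R) s →
    Halts (while (less rzero rrules) parseStep) s (loopTime parseStep (ℓ R)) Parsed
  parse-halts s I =
    let (s′ , t , d , t≤ , fin , m , J) =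
          loop (less rzero rrules) parseStep (ParseInv w R (length xs))
               (parseStep-correct w R (length xs)) (3 * ℓ R) work≤3ℓ I
    in s′ , t , d , t≤ , finished J fin
    where
    finished : ∀ {m s} → ParseInv w R (length xs) m s →
               test (less rzero rrules) s ≡ false → Parsed s
    finished (idle {G} {L} {[]} _ _ _ _ P) _ = G , L , P
    finished {s = s} (idle {R′ = _ ∷ _} _ nr≡ _ _ P) t = contradiction
      (subst₂ _≤_ nr≡ (Core.zero-const (Parsing.core P)) (less-false {rzero} {rrules} {s} t)) n≮0
    finished {s = s} (busy _ nr≡ _ _ _ _ _ P) t = contradiction
      (subst₂ _≤_ nr≡ (Core.zero-const (Parsing.core P)) (less-false {rzero} {rrules} {s} t)) n≮0

  Marked : List (Placed n) → List (Occurrence n) → List (Fin n) → State → Set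
  Marked G L ys s = ∃[ X′ ] ∃[ Y ] Marking w X (length xs) G L rest ys X′ Y s

  rewind-halts : ∀ {G L} s → Parsing w R (length xs) G L [] Nothing 0 s →
    Halts rewind s (cost rewind) (Marked G L xs)
  rewind-halts {G} {L} s P = straight rewind s (Marked G L xs) (⊥ , ⊥ , record
    { core = core ; closed = λ q∈ → contradiction q∈ ∉⊥ ; pending = pending
    ; word = word ; ssize = ssize ; sqh = sqh ; left = ssize ; suffix = afterSetup
    ; unique = proj₁ ls ; unseen = λ _ → ∉⊥ ; X′⊆X = ⊆-min X
    ; xs⊆X = λ x∈ → Equivalence.to (proj₂ ls _) x∈
    ; cover = λ x∈ → inj₂ (Equivalence.from (proj₂ ls _) x∈) })
    where open Parsing P

  Marked-out : List (Placed n) → List (Occurrence n) → State → Set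
  Marked-out G L s = ∃[ Y ] Propagating X (length xs) G L Y s

  mark-halts : ∀ {G L} s → Marked G L xs s →
    Halts (while (less rzero rleft) markStep) s (loopTime markStep (ℓ R)) (Marked-out G L)
  mark-halts {G} {L} s (_ , _ , I) =
    let (s′ , t , d , t≤ , fin , m , J) =
          loop (less rzero rleft) markStep (MarkInv w X (length xs) G L rest)
               (markStep-correct w X (length xs) G L rest) (3 * ℓ R) ∣xs∣≤3ℓ (marking I)
    in s′ , t , d , t≤ , finished J fin
    where
    finished : ∀ {m s} → MarkInv w X (length xs) G L rest m s →
               test (less rzero rleft) s ≡ false → Marked-out G L s
    finished {s = s} (marking {_ ∷ _} I) t = contradiction
      (subst₂ _≤_ (Marking.left I) (Core.zero-const (Marking.core I))
              (less-false {rzero} {rleft} {s} t)) n≮0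
    finished {s = s} (marking {[]} {X′} {Y} I) _ = Y , record
      { core = subst (λ X → Core X Y G (view s)) X′≡X core
      ; closed = subst (λ X → Closed X Y G (arr s hit)) X′≡X closed
      ; pending = pending ; ssize = ssize
      ; retired = λ i< → contradiction (subst (_ <_) sqh i<) n≮0 }
      where
      open Marking I
      X⊆X′ : X ⊆ X′
      X⊆X′ x∈ with inj₁ x∈X′ ← cover x∈ = x∈X′
      X′≡X : X′ ≡ X
      X′≡X = ⊆-antisym X′⊆X X⊆X′

  Propagated : List (Placed n) → State → Set
  Propagated G s = reg s rqt ≤ reg s rqh ×
                   ∃[ L ] ∃[ Y ] Propagating X (length xs) G L Y s

  propagate-halts : ∀ {G L} → length L ≤ work R → ∀ s → Marked-out G L s →
    Halts (while (less rqh rqt) propagateStep) s (loopTime propagateStep (ℓ R)) (Propagated G)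
  propagate-halts {G} {L} ∣L∣≤ s (_ , I) =
    let (s′ , t , d , t≤ , fin , m , J) =
          loop (less rqh rqt) propagateStep (PropagateInv X (length xs) G)
               (propagateStep-correct X (length xs) G) (3 * ℓ R) bound (propagating I)
    in s′ , t , d , t≤ , finished J fin
    where
    bound : length L + (n ∸ reg s rqh) ≤ 3 * ℓ R
    bound = ≤-trans (+-mono-≤ (≤-trans ∣L∣≤ (work≤2ℓ R)) (≤-trans (m∸n≤m n (reg s rqh)) n≤ℓ))
                    -- `3 * ℓ R` unfolds to `ℓ R + 2 * ℓ R`, so only the order of the summands
                    -- differs.
                    (≤-reflexive (+-comm (2 * ℓ R) (ℓ R)))
    finished : ∀ {m s} → PropagateInv X (length xs) G m s →
               test (less rqh rqt) s ≡ false → Propagated G s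
    finished {s = s} (propagating I) t = less-false {rqh} {rqt} {s} t , _ , _ , I

  answer-halts : ∀ {G} → map proj₂ G ʳ++ [] ≡ R → ∀ s → Propagated G s →
    Halts answer s (cost answer) (λ s′ → Answers s′ (𝒜 R X))
  answer-halts {G} refl s (done , _ , _ , I) = straight answer s (λ s′ → Answers s′ (𝒜 R X))
    (answer-correct X (length xs) G I done (length-Lists ls))

  algorithm-halts : Halts algorithm (initial w) (time (ℓ R)) (λ s → Answers s (𝒜 R X))
  algorithm-halts =
    setup-halts then λ s I → skip-halts s I then λ s I → findRules-halts s I then λ s I →
    parse-halts s I then λ { s (G , L , P) → rewind-halts s P then λ s I →
    mark-halts s I then λ s I →
    propagate-halts (≤-trans (m≤m+n (length L) 0) (Parsing.budget P)) s I then
    answer-halts (Parsing.split P) }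

theorem1p2 : ∃[ P ] ∃[ T ] T ∈O (λ l → l) ×
    (∀ n (R : List (Rule n)) (X : Subset n) (w : List ℕ) →
    Unique R → n ≤ ℓ R → Encodes R X w →
    DecidesWithin P (T (ℓ R)) w R X)
theorem1p2 = algorithm , time , time-linear ,
  λ { n R X _ _ n≤ℓ (encode ls enc) → Run.algorithm-halts n≤ℓ ls enc }
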